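{- For every positive integer $k$ and every Boolean symmetric function $F:\{0,1\}^k\to\mathbb{C}$, there is a planar gadget with signature $F$ that has $O(k)$ vertices and in which every vertex is assigned a Boolean function of arity no more than $5$.
   Context: $\mathbb{C}$ denotes the algebraic complex numbers. A Boolean function of arity $k$ is a map $\{0,1\}^k\to\mathbb{C}$; it is symmetric if its value is invariant under all permutations of its inputs, i.e. depends only on the Hamming weight of the input. A gadget is a pair $(G,\pi)$ where $G=(V,E\cup X)$ is a graph whose edges split into the set $E$ of ordinary edges (both endpoints in $V$) and the set $X$ of dangling edges (one endpoint in $V$, the other end dangling), and $\pi$ assigns to every vertex $v\in V$ a Boolean function $F_v$ of arity equal to the degree of $v$ (dangling edges included), together with a linear order on the set $N(v)$ of edges incident to $v$. With $k=|X|$, the signature of the gadget is the function $$\Gamma(y_1,\dots,y_k)=\sum_{\sigma:E\to\{0,1\}}\ \prod_{v\in V}F_v\big(\hat\sigma|_{N(v)}\big),$$ where $(y_1,\dots,y_k)\in\{0,1\}^k$ is the assignment to $X$ and $\hat\sigma$ is the extension of $\sigma$ to $E\cup X$ by $(y_1,\dots,y_k)$. The gadget is planar if it can be drawn in the plane without crossings with all dangling edges lying in the outer face. The constant in $O(\cdot)$ is absolute. -}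

module Defs where

open import Level using (0ℓ)
open import Algebra.Bundles using (CommutativeRing)
open import Data.Nat as ℕ using (ℕ; zero; suc; _⊔_)
import Data.Nat.Properties as ℕₚ
open import Data.Integer as ℤ using (ℤ)
open import Data.Rational as ℚ using (ℚ; 0ℚ; 1ℚ; ½; _/_; ∣_∣)
import Data.Rational.Properties as ℚₚ
open import Data.Rational.Solver using (module +-*-Solver)
open import Data.Bool using (Bool; true; false)
open import Data.Fin using (Fin)
open import Data.Fin.Permutation using (Permutation′; _⟨$⟩ʳ_)
open import Data.List using (List; []; _∷_; length)
open import Data.List.Membership.Propositional using (_∈_)
open import Data.List.Relation.Unary.Any using (Any)
open import Data.List.Relation.Unary.Unique.Propositional using (Unique)
open import Data.Vec as Vec using (Vec; []; _∷_; lookup; tabulate; fromList)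
open import Data.Product using (∃; ∃-syntax; _×_; _,_; proj₁; proj₂)
open import Data.Sum using (_⊎_; inj₁; inj₂; [_,_]′)
open import Function.Bundles using (_⇔_)
open import Function.Definitions using (Injective)
open import Relation.Nullary using (¬_)
open import Relation.Binary.Structures using (IsEquivalence)
open import Relation.Binary.PropositionalEquality using (_≡_; _≢_; refl; sym; trans; cong; subst)

import Algebra.Definitions.RawMonoid as RawMonoidOps

-- Real numbers are Cauchy sequences of rationals; two are equal when their
-- difference is a null sequence.
Cauchy : (ℕ → ℚ) → Set
Cauchy s = ∀ ε → 0ℚ ℚ.< ε →
  ∃[ N ] (∀ m n → N ℕ.≤ m → N ℕ.≤ n → ∣ s m ℚ.- s n ∣ ℚ.< ε)

record ℝ : Set where
  constructor mkℝ
  field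
    seq    : ℕ → ℚ
    cauchy : Cauchy seq

open ℝ public

infix 4 _≈ℝ_

record _≈ℝ_ (x y : ℝ) : Set where
  constructor mk≈ℝ
  field
    null : ∀ ε → 0ℚ ℚ.< ε →
      ∃[ N ] (∀ n → N ℕ.≤ n → ∣ seq x n ℚ.- seq y n ∣ ℚ.< ε)

open _≈ℝ_ public

private
  abstract
    half>0 : ∀ {ε} → 0ℚ ℚ.< ε → 0ℚ ℚ.< ½ ℚ.* ε
    half>0 {ε} 0<ε =
      subst (ℚ._< ½ ℚ.* ε) (ℚₚ.*-zeroʳ ½) (ℚₚ.*-monoʳ-<-pos ½ 0<ε)

    half+half : ∀ ε → ½ ℚ.* ε ℚ.+ ½ ℚ.* ε ≡ ε
    half+half ε = trans (sym (ℚₚ.*-distribʳ-+ ε ½ ½)) (ℚₚ.*-identityˡ ε)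

    +-small : ∀ {ε a b} → ∣ a ∣ ℚ.< ½ ℚ.* ε → ∣ b ∣ ℚ.< ½ ℚ.* ε → ∣ a ℚ.+ b ∣ ℚ.< ε
    +-small {ε} {a} {b} a< b< =
      ℚₚ.≤-<-trans (ℚₚ.∣p+q∣≤∣p∣+∣q∣ a b)
        (subst (∣ a ∣ ℚ.+ ∣ b ∣ ℚ.<_) (half+half ε) (ℚₚ.+-mono-< a< b<))

    inv : ∀ {B} → 0ℚ ℚ.< B → ℚ
    inv {B} 0<B = ℚ.1/_ B {{ℚₚ.pos⇒nonZero B {{ℚ.positive 0<B}}}}

    quot : ∀ {B} → 0ℚ ℚ.< B → ℚ → ℚ
    quot 0<B ε = inv 0<B ℚ.* ε

    quot>0 : ∀ {B ε} (0<B : 0ℚ ℚ.< B) → 0ℚ ℚ.< ε → 0ℚ ℚ.< quot 0<B ε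
    quot>0 {B} {ε} 0<B 0<ε = subst (ℚ._< quot 0<B ε) (ℚₚ.*-zeroʳ (inv 0<B))
      (ℚₚ.*-monoʳ-<-pos (inv 0<B) {{ℚₚ.1/pos⇒pos B {{ℚ.positive 0<B}}}} 0<ε)

    *-small : ∀ {B ε a b} (0<B : 0ℚ ℚ.< B) → ∣ a ∣ ℚ.< B → ∣ b ∣ ℚ.< quot 0<B ε →
              ∣ a ℚ.* b ∣ ℚ.< ε
    *-small {B} {ε} {a} {b} 0<B a< b< =
      subst (ℚ._< ε) (sym (ℚₚ.∣p*q∣≡∣p∣*∣q∣ a b))
        (ℚₚ.≤-<-trans
          (ℚₚ.*-monoʳ-≤-nonNeg ∣ b ∣ {{ℚₚ.∣-∣-nonNeg b}} (ℚₚ.<⇒≤ a<))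
          (subst (B ℚ.* ∣ b ∣ ℚ.<_) B*quot
            (ℚₚ.*-monoʳ-<-pos B {{ℚ.positive 0<B}} b<)))
      where
      B*quot : B ℚ.* quot 0<B ε ≡ ε
      B*quot = trans (sym (ℚₚ.*-assoc B (inv 0<B) ε))
        (trans (cong (ℚ._* ε) (ℚₚ.*-inverseʳ B {{ℚₚ.pos⇒nonZero B {{ℚ.positive 0<B}}}}))
               (ℚₚ.*-identityˡ ε))

    bounded : ∀ x → ∃[ B ] 0ℚ ℚ.< B × ∃[ N ] (∀ n → N ℕ.≤ n → ∣ seq x n ∣ ℚ.< B)
    bounded x with cauchy x 1ℚ (ℚₚ.positive⁻¹ 1ℚ)
    ... | N , close = 1ℚ ℚ.+ ∣ seq x N ∣ , 0<B , N , λ n N≤n →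
      subst (λ q → ∣ q ∣ ℚ.< 1ℚ ℚ.+ ∣ seq x N ∣) (recombine (seq x n) (seq x N))
        (ℚₚ.≤-<-trans (ℚₚ.∣p+q∣≤∣p∣+∣q∣ (seq x n ℚ.- seq x N) (seq x N))
          (ℚₚ.+-mono-<-≤ (close n N N≤n ℕₚ.≤-refl) ℚₚ.≤-refl))
      where
      0<B : 0ℚ ℚ.< 1ℚ ℚ.+ ∣ seq x N ∣
      0<B = ℚₚ.+-mono-<-≤ {0ℚ} {1ℚ} (ℚₚ.positive⁻¹ 1ℚ) (ℚₚ.0≤∣p∣ (seq x N))
      recombine : ∀ a b → (a ℚ.- b) ℚ.+ b ≡ a
      recombine = solve 2 (λ a b → (a :- b) :+ b := a) refl
        where open +-*-Solver

    +-swap : ∀ a b c d → (a ℚ.- c) ℚ.+ (b ℚ.- d) ≡ (a ℚ.+ b) ℚ.- (c ℚ.+ d)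
    +-swap = solve 4 (λ a b c d → (a :- c) :+ (b :- d) := (a :+ b) :- (c :+ d)) refl
      where open +-*-Solver

    *-swap : ∀ a b c d → a ℚ.* (b ℚ.- d) ℚ.+ d ℚ.* (a ℚ.- c) ≡ a ℚ.* b ℚ.- c ℚ.* d
    *-swap = solve 4 (λ a b c d → a :* (b :- d) :+ d :* (a :- c) := a :* b :- c :* d) refl
      where open +-*-Solver

    neg-swap : ∀ a b → ℚ.- (a ℚ.- b) ≡ (ℚ.- a) ℚ.- (ℚ.- b)
    neg-swap = solve 2 (λ a b → :- (a :- b) := (:- a) :- (:- b)) refl
      where open +-*-Solver

    neg-small : ∀ {ε} a b → ∣ a ℚ.- b ∣ ℚ.< ε → ∣ (ℚ.- a) ℚ.- (ℚ.- b) ∣ ℚ.< ε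
    neg-small {ε} a b =
      subst (ℚ._< ε) (trans (sym (ℚₚ.∣-p∣≡∣p∣ (a ℚ.- b))) (cong ∣_∣ (neg-swap a b)))

    const-cauchy : ∀ q → Cauchy (λ _ → q)
    const-cauchy q ε 0<ε = 0 , λ _ _ _ _ →
      subst (λ r → ∣ r ∣ ℚ.< ε) (sym (ℚₚ.+-inverseʳ q)) 0<ε

fromℚ : ℚ → ℝ
fromℚ q = mkℝ (λ _ → q) (const-cauchy q)

infixl 6 _+ℝ_
infixl 7 _*ℝ_
infix  8 -ℝ_

private
  abstract
    +-cauchy : ∀ x y → Cauchy (λ n → seq x n ℚ.+ seq y n)
    +-cauchy x y ε 0<ε =
      let M , p = cauchy x _ (half>0 0<ε)
          N , q = cauchy y _ (half>0 0<ε)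
      in M ⊔ N , λ m n m≥ n≥ →
        subst (λ r → ∣ r ∣ ℚ.< ε) (+-swap (seq x m) (seq y m) (seq x n) (seq y n))
          (+-small (p m n (ℕₚ.m⊔n≤o⇒m≤o M N m≥) (ℕₚ.m⊔n≤o⇒m≤o M N n≥))
                   (q m n (ℕₚ.m⊔n≤o⇒n≤o M N m≥) (ℕₚ.m⊔n≤o⇒n≤o M N n≥)))

    neg-cauchy : ∀ x → Cauchy (λ n → ℚ.- seq x n)
    neg-cauchy x ε 0<ε = let N , p = cauchy x ε 0<ε in
      N , λ m n m≥ n≥ → neg-small (seq x m) (seq x n) (p m n m≥ n≥)

    *-cauchy : ∀ x y → Cauchy (λ n → seq x n ℚ.* seq y n)
    *-cauchy x y ε 0<ε =
      let A , 0<A , K , a = bounded x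
          B , 0<B , L , b = bounded y
          M , p = cauchy y _ (quot>0 0<A (half>0 0<ε))
          N , q = cauchy x _ (quot>0 0<B (half>0 0<ε))
      in (K ⊔ L) ⊔ (M ⊔ N) , λ m n m≥ n≥ →
        let KL≤m = ℕₚ.m⊔n≤o⇒m≤o (K ⊔ L) (M ⊔ N) m≥
            MN≤m = ℕₚ.m⊔n≤o⇒n≤o (K ⊔ L) (M ⊔ N) m≥
            KL≤n = ℕₚ.m⊔n≤o⇒m≤o (K ⊔ L) (M ⊔ N) n≥
            MN≤n = ℕₚ.m⊔n≤o⇒n≤o (K ⊔ L) (M ⊔ N) n≥
        in subst (λ r → ∣ r ∣ ℚ.< ε) (*-swap (seq x m) (seq y m) (seq x n) (seq y n))
          (+-small
            (*-small 0<A (a m (ℕₚ.m⊔n≤o⇒m≤o K L KL≤m))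
              (p m n (ℕₚ.m⊔n≤o⇒m≤o M N MN≤m) (ℕₚ.m⊔n≤o⇒m≤o M N MN≤n)))
            (*-small 0<B (b n (ℕₚ.m⊔n≤o⇒n≤o K L KL≤n))
              (q m n (ℕₚ.m⊔n≤o⇒n≤o M N MN≤m) (ℕₚ.m⊔n≤o⇒n≤o M N MN≤n))))

_+ℝ_ : ℝ → ℝ → ℝ
x +ℝ y = mkℝ (λ n → seq x n ℚ.+ seq y n) (+-cauchy x y)

-ℝ_ : ℝ → ℝ
-ℝ x = mkℝ (λ n → ℚ.- seq x n) (neg-cauchy x)

_*ℝ_ : ℝ → ℝ → ℝ
x *ℝ y = mkℝ (λ n → seq x n ℚ.* seq y n) (*-cauchy x y)

private
  pointwise : ∀ {x y} → (∀ n → seq x n ≡ seq y n) → x ≈ℝ y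
  pointwise {x} {y} eq = mk≈ℝ λ ε 0<ε → 0 , λ n _ →
    subst (λ r → ∣ r ∣ ℚ.< ε)
      (sym (trans (cong (ℚ._- seq y n) (eq n)) (ℚₚ.+-inverseʳ (seq y n)))) 0<ε

  ≈ℝ-sym : ∀ {x y} → x ≈ℝ y → y ≈ℝ x
  ≈ℝ-sym {x} {y} x≈y = mk≈ℝ λ ε 0<ε → let N , p = null x≈y ε 0<ε in
    N , λ n n≥ → subst (ℚ._< ε)
      (trans (sym (ℚₚ.∣-p∣≡∣p∣ (seq x n ℚ.- seq y n)))
             (cong ∣_∣ (flip- (seq x n) (seq y n))))
      (p n n≥)
    where
    flip- : ∀ a b → ℚ.- (a ℚ.- b) ≡ b ℚ.- a
    flip- = solve 2 (λ a b → :- (a :- b) := b :- a) refl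
      where open +-*-Solver

  ≈ℝ-trans : ∀ {x y z} → x ≈ℝ y → y ≈ℝ z → x ≈ℝ z
  ≈ℝ-trans {x} {y} {z} x≈y y≈z = mk≈ℝ λ ε 0<ε →
    let M , p = null x≈y _ (half>0 0<ε)
        N , q = null y≈z _ (half>0 0<ε)
    in M ⊔ N , λ n n≥ →
      subst (λ r → ∣ r ∣ ℚ.< ε) (telescope (seq x n) (seq y n) (seq z n))
        (+-small (p n (ℕₚ.m⊔n≤o⇒m≤o M N n≥)) (q n (ℕₚ.m⊔n≤o⇒n≤o M N n≥)))
    where
    telescope : ∀ a b c → (a ℚ.- b) ℚ.+ (b ℚ.- c) ≡ a ℚ.- c
    telescope = solve 3 (λ a b c → (a :- b) :+ (b :- c) := a :- c) refl
      where open +-*-Solver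

  +ℝ-cong : ∀ {x y u v} → x ≈ℝ y → u ≈ℝ v → x +ℝ u ≈ℝ y +ℝ v
  +ℝ-cong {x} {y} {u} {v} x≈y u≈v = mk≈ℝ λ ε 0<ε →
    let M , p = null x≈y _ (half>0 0<ε)
        N , q = null u≈v _ (half>0 0<ε)
    in M ⊔ N , λ n n≥ →
      subst (λ r → ∣ r ∣ ℚ.< ε) (+-swap (seq x n) (seq u n) (seq y n) (seq v n))
        (+-small (p n (ℕₚ.m⊔n≤o⇒m≤o M N n≥)) (q n (ℕₚ.m⊔n≤o⇒n≤o M N n≥)))

  -ℝ-cong : ∀ {x y} → x ≈ℝ y → -ℝ x ≈ℝ -ℝ y
  -ℝ-cong {x} {y} x≈y = mk≈ℝ λ ε 0<ε → let N , p = null x≈y ε 0<ε in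
    N , λ n n≥ → neg-small (seq x n) (seq y n) (p n n≥)

  *ℝ-cong : ∀ {x y u v} → x ≈ℝ y → u ≈ℝ v → x *ℝ u ≈ℝ y *ℝ v
  *ℝ-cong {x} {y} {u} {v} x≈y u≈v = mk≈ℝ λ ε 0<ε →
    let A , 0<A , K , a = bounded x
        B , 0<B , L , b = bounded v
        M , p = null u≈v _ (quot>0 0<A (half>0 0<ε))
        N , q = null x≈y _ (quot>0 0<B (half>0 0<ε))
    in (K ⊔ L) ⊔ (M ⊔ N) , λ n n≥ →
      let KL≤n = ℕₚ.m⊔n≤o⇒m≤o (K ⊔ L) (M ⊔ N) n≥
          MN≤n = ℕₚ.m⊔n≤o⇒n≤o (K ⊔ L) (M ⊔ N) n≥
      in subst (λ r → ∣ r ∣ ℚ.< ε) (*-swap (seq x n) (seq u n) (seq y n) (seq v n))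
        (+-small
          (*-small 0<A (a n (ℕₚ.m⊔n≤o⇒m≤o K L KL≤n)) (p n (ℕₚ.m⊔n≤o⇒m≤o M N MN≤n)))
          (*-small 0<B (b n (ℕₚ.m⊔n≤o⇒n≤o K L KL≤n)) (q n (ℕₚ.m⊔n≤o⇒n≤o M N MN≤n))))

  ≈ℝ-isEquivalence : IsEquivalence _≈ℝ_
  ≈ℝ-isEquivalence = record
    { refl  = pointwise λ _ → refl
    ; sym   = ≈ℝ-sym
    ; trans = ≈ℝ-trans
    }

ℝ-commutativeRing : CommutativeRing 0ℓ 0ℓ
ℝ-commutativeRing = record
  { Carrier = ℝ
  ; _≈_     = _≈ℝ_
  ; _+_     = _+ℝ_
  ; _*_     = _*ℝ_
  ; -_      = -ℝ_
  ; 0#      = fromℚ 0ℚ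
  ; 1#      = fromℚ 1ℚ
  ; isCommutativeRing = record
    { isRing = record
      { +-isAbelianGroup = record
        { isGroup = record
          { isMonoid = record
            { isSemigroup = record
              { isMagma = record { isEquivalence = ≈ℝ-isEquivalence ; ∙-cong = +ℝ-cong }
              ; assoc = λ x y z → pointwise λ n → ℚₚ.+-assoc (seq x n) (seq y n) (seq z n)
              }
            ; identity = (λ x → pointwise λ n → ℚₚ.+-identityˡ (seq x n))
                       , (λ x → pointwise λ n → ℚₚ.+-identityʳ (seq x n))
            }
          ; inverse = (λ x → pointwise λ n → ℚₚ.+-inverseˡ (seq x n))
                    , (λ x → pointwise λ n → ℚₚ.+-inverseʳ (seq x n))
          ; ⁻¹-cong = -ℝ-cong
          }
        ; comm = λ x y → pointwise λ n → ℚₚ.+-comm (seq x n) (seq y n)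
        }
      ; *-cong     = *ℝ-cong
      ; *-assoc    = λ x y z → pointwise λ n → ℚₚ.*-assoc (seq x n) (seq y n) (seq z n)
      ; *-identity = (λ x → pointwise λ n → ℚₚ.*-identityˡ (seq x n))
                   , (λ x → pointwise λ n → ℚₚ.*-identityʳ (seq x n))
      ; distrib    = (λ x y z → pointwise λ n → ℚₚ.*-distribˡ-+ (seq x n) (seq y n) (seq z n))
                   , (λ x y z → pointwise λ n → ℚₚ.*-distribʳ-+ (seq x n) (seq y n) (seq z n))
      }
    ; *-comm = λ x y → pointwise λ n → ℚₚ.*-comm (seq x n) (seq y n)
    }
  }

record ℂ : Set where
  constructor _+i_
  field
    re im : ℝ

open ℂ public

infix 4 _≈ℂ_

record _≈ℂ_ (z w : ℂ) : Set where
  constructor _+i_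
  field
    re≈ : re z ≈ℝ re w
    im≈ : im z ≈ℝ im w

infixl 6 _+ℂ_
infixl 7 _*ℂ_

_+ℂ_ _*ℂ_ : ℂ → ℂ → ℂ
(a +i b) +ℂ (c +i d) = (a +ℝ c) +i (b +ℝ d)
(a +i b) *ℂ (c +i d) = (a *ℝ c +ℝ (-ℝ (b *ℝ d))) +i (a *ℝ d +ℝ b *ℝ c)

-ℂ_ : ℂ → ℂ
-ℂ (a +i b) = (-ℝ a) +i (-ℝ b)

fromℤ : ℤ → ℂ
fromℤ n = fromℚ (n / 1) +i fromℚ 0ℚ

private
  module R = CommutativeRing ℝ-commutativeRing

ℂ-commutativeRing : CommutativeRing 0ℓ 0ℓ
ℂ-commutativeRing = record
  { Carrier = ℂ
  ; _≈_     = _≈ℂ_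
  ; _+_     = _+ℂ_
  ; _*_     = _*ℂ_
  ; -_      = -ℂ_
  ; 0#      = fromℚ 0ℚ +i fromℚ 0ℚ
  ; 1#      = fromℚ 1ℚ +i fromℚ 0ℚ
  ; isCommutativeRing = record
    { isRing = record
      { +-isAbelianGroup = record
        { isGroup = record
          { isMonoid = record
            { isSemigroup = record
              { isMagma = record
                { isEquivalence = record
                  { refl  = R.refl +i R.refl
                  ; sym   = λ { (p +i q) → R.sym p +i R.sym q }
                  ; trans = λ { (p +i q) (r +i s) → R.trans p r +i R.trans q s }
                  }
                ; ∙-cong = λ { (p +i q) (r +i s) → R.+-cong p r +i R.+-cong q s }
                }
              ; assoc = λ x y z → R.+-assoc _ _ _ +i R.+-assoc _ _ _
              }
            ; identity = (λ x → R.+-identityˡ _ +i R.+-identityˡ _)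
                       , (λ x → R.+-identityʳ _ +i R.+-identityʳ _)
            }
          ; inverse = (λ x → R.-‿inverseˡ _ +i R.-‿inverseˡ _)
                    , (λ x → R.-‿inverseʳ _ +i R.-‿inverseʳ _)
          ; ⁻¹-cong = λ { (p +i q) → R.-‿cong p +i R.-‿cong q }
          }
        ; comm = λ x y → R.+-comm _ _ +i R.+-comm _ _
        }
      ; *-cong = λ { (p +i q) (r +i s) →
            R.+-cong (R.*-cong p r) (R.-‿cong (R.*-cong q s))
         +i R.+-cong (R.*-cong p s) (R.*-cong q r) }
      ; *-assoc = *-assoc
      ; *-identity = identityˡ , (λ z → ≈ℂ-trans (*-comm z _) (identityˡ z))
      ; distrib = distribˡ , (λ x y z → ≈ℂ-trans (*-comm (y +ℂ z) x)
          (≈ℂ-trans (distribˡ x y z) (+-cong (*-comm x y) (*-comm x z))))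
      }
    ; *-comm = *-comm
    }
  }
  where
  ≈ℂ-trans : ∀ {x y z} → x ≈ℂ y → y ≈ℂ z → x ≈ℂ z
  ≈ℂ-trans (p +i q) (r +i s) = R.trans p r +i R.trans q s

  +-cong : ∀ {x y u v} → x ≈ℂ y → u ≈ℂ v → x +ℂ u ≈ℂ y +ℂ v
  +-cong (p +i q) (r +i s) = R.+-cong p r +i R.+-cong q s

  *-comm : ∀ x y → x *ℂ y ≈ℂ y *ℂ x
  *-comm (a +i b) (c +i d) =
       R.+-cong (R.*-comm a c) (R.-‿cong (R.*-comm b d))
    +i R.trans (R.+-comm _ _) (R.+-cong (R.*-comm b c) (R.*-comm a d))

  identityˡ : ∀ z → (fromℚ 1ℚ +i fromℚ 0ℚ) *ℂ z ≈ℂ z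
  identityˡ (a +i b) =
       pointwise (λ n → re-eq (seq a n) (seq b n))
    +i pointwise (λ n → im-eq (seq a n) (seq b n))
    where
    re-eq : ∀ a b → 1ℚ ℚ.* a ℚ.- 0ℚ ℚ.* b ≡ a
    re-eq = solve 2 (λ a b → con 1ℚ :* a :- con 0ℚ :* b := a) refl
      where open +-*-Solver
    im-eq : ∀ a b → 1ℚ ℚ.* b ℚ.+ 0ℚ ℚ.* a ≡ b
    im-eq = solve 2 (λ a b → con 1ℚ :* b :+ con 0ℚ :* a := b) refl
      where open +-*-Solver

  *-assoc : ∀ x y z → (x *ℂ y) *ℂ z ≈ℂ x *ℂ (y *ℂ z)
  *-assoc (a +i b) (c +i d) (e +i f) =
       pointwise (λ n → re-eq (seq a n) (seq b n) (seq c n) (seq d n) (seq e n) (seq f n))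
    +i pointwise (λ n → im-eq (seq a n) (seq b n) (seq c n) (seq d n) (seq e n) (seq f n))
    where
    re-eq : ∀ a b c d e f →
      (a ℚ.* c ℚ.- b ℚ.* d) ℚ.* e ℚ.- (a ℚ.* d ℚ.+ b ℚ.* c) ℚ.* f ≡
      a ℚ.* (c ℚ.* e ℚ.- d ℚ.* f) ℚ.- b ℚ.* (c ℚ.* f ℚ.+ d ℚ.* e)
    re-eq = solve 6 (λ a b c d e f →
      (a :* c :- b :* d) :* e :- (a :* d :+ b :* c) :* f :=
      a :* (c :* e :- d :* f) :- b :* (c :* f :+ d :* e)) refl
      where open +-*-Solver
    im-eq : ∀ a b c d e f →
      (a ℚ.* c ℚ.- b ℚ.* d) ℚ.* f ℚ.+ (a ℚ.* d ℚ.+ b ℚ.* c) ℚ.* e ≡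
      a ℚ.* (c ℚ.* f ℚ.+ d ℚ.* e) ℚ.+ b ℚ.* (c ℚ.* e ℚ.- d ℚ.* f)
    im-eq = solve 6 (λ a b c d e f →
      (a :* c :- b :* d) :* f :+ (a :* d :+ b :* c) :* e :=
      a :* (c :* f :+ d :* e) :+ b :* (c :* e :- d :* f)) refl
      where open +-*-Solver

  distribˡ : ∀ x y z → x *ℂ (y +ℂ z) ≈ℂ x *ℂ y +ℂ x *ℂ z
  distribˡ (a +i b) (c +i d) (e +i f) =
       pointwise (λ n → re-eq (seq a n) (seq b n) (seq c n) (seq d n) (seq e n) (seq f n))
    +i pointwise (λ n → im-eq (seq a n) (seq b n) (seq c n) (seq d n) (seq e n) (seq f n))
    where
    re-eq : ∀ a b c d e f →
      a ℚ.* (c ℚ.+ e) ℚ.- b ℚ.* (d ℚ.+ f) ≡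
      (a ℚ.* c ℚ.- b ℚ.* d) ℚ.+ (a ℚ.* e ℚ.- b ℚ.* f)
    re-eq = solve 6 (λ a b c d e f →
      a :* (c :+ e) :- b :* (d :+ f) :=
      (a :* c :- b :* d) :+ (a :* e :- b :* f)) refl
      where open +-*-Solver
    im-eq : ∀ a b c d e f →
      a ℚ.* (d ℚ.+ f) ℚ.+ b ℚ.* (c ℚ.+ e) ≡
      (a ℚ.* d ℚ.+ b ℚ.* c) ℚ.+ (a ℚ.* f ℚ.+ b ℚ.* e)
    im-eq = solve 6 (λ a b c d e f →
      a :* (d :+ f) :+ b :* (c :+ e) :=
      (a :* d :+ b :* c) :+ (a :* f :+ b :* e)) refl
      where open +-*-Solver

open CommutativeRing ℂ-commutativeRing public
  using () renaming (0# to 0ℂ; 1# to 1ℂ; *-rawMonoid to ℂ-*-rawMonoid)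

-- A polynomial is its list of coefficients, constant term first.
evalPoly : List ℤ → ℂ → ℂ
evalPoly []      z = 0ℂ
evalPoly (c ∷ p) z = fromℤ c +ℂ z *ℂ evalPoly p z

Algebraic : ℂ → Set
Algebraic z = ∃[ p ] Any (_≢ ℤ.0ℤ) p × evalPoly p z ≈ℂ 0ℂ

record 𝔸 : Set where
  constructor mk𝔸
  field
    value     : ℂ
    algebraic : Algebraic value

open 𝔸 public

BoolFun : ℕ → Set
BoolFun k = Vec Bool k → 𝔸

permute : ∀ {k} → Permutation′ k → Vec Bool k → Vec Bool k
permute π x = tabulate λ i → lookup x (π ⟨$⟩ʳ i)

Symmetric : ∀ {k} → BoolFun k → Set
Symmetric {k} F = ∀ (π : Permutation′ k) x → value (F (permute π x)) ≈ℂ value (F x)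

sumBool : ∀ m → (Vec Bool m → ℂ) → ℂ
sumBool zero    f = f []
sumBool (suc m) f = sumBool m (λ σ → f (false ∷ σ)) +ℂ sumBool m (λ σ → f (true ∷ σ))

prodFin : ∀ {n} → (Fin n → ℂ) → ℂ
prodFin = RawMonoidOps.sum ℂ-*-rawMonoid

-- A finite simple graph with k dangling edges. Ordinary edges are indexed by
-- Fin m and dangling edges by Fin k; dangling edges may share a vertex.
record Graph (k : ℕ) : Set where
  field
    n m    : ℕ
    ends   : Fin m → Fin n × Fin n
    attach : Fin k → Fin n

  Vertex : Set
  Vertex = Fin n

  Edge : Set
  Edge = Fin m ⊎ Fin k

  Incident : Vertex → Edge → Set
  Incident v = [ (λ e → v ≡ proj₁ (ends e) ⊎ v ≡ proj₂ (ends e))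
               , (λ d → v ≡ attach d) ]′

  field
    loopless   : ∀ e → proj₁ (ends e) ≢ proj₂ (ends e)
    noParallel : ∀ e e′ → (∀ v → Incident v (inj₁ e) → Incident v (inj₁ e′)) → e ≡ e′

record Gadget (k : ℕ) : Set where
  field
    graph : Graph k

  open Graph graph public

  -- N v lists the edges at v in the linear order chosen at v. There are no
  -- loops, so its length is the degree of v.
  field
    N          : Vertex → List Edge
    N-unique   : ∀ v → Unique (N v)
    N-incident : ∀ v e → e ∈ N v ⇔ Incident v e

  degree : Vertex → ℕ
  degree v = length (N v)

  field
    fun : ∀ v → BoolFun (degree v)

  signature : Vec Bool k → ℂ
  signature y = sumBool m λ σ → prodFin λ v →
    value (fun v (Vec.map [ lookup σ , lookup y ]′ (fromList (N v))))

-- Drawings are polygonal with rational coordinates. Segments with rational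
-- ends that meet in the real plane also meet in a rational point, so testing
-- rational points suffices to exclude crossings.
Point : Set
Point = ℚ × ℚ

infix 4 _∈[_,_]

_∈[_,_] : Point → Point → Point → Set
(x , y) ∈[ (x₀ , y₀) , (x₁ , y₁) ] = ∃[ t ] 0ℚ ℚ.≤ t × t ℚ.≤ 1ℚ ×
  x ≡ (1ℚ ℚ.- t) ℚ.* x₀ ℚ.+ t ℚ.* x₁ ×
  y ≡ (1ℚ ℚ.- t) ℚ.* y₀ ℚ.+ t ℚ.* y₁

-- q lies on the polygonal path from a to b through the given bends.
OnPath : (a : Point) (bends : List Point) (b : Point) → Point → Set
OnPath a []       b q = q ∈[ a , b ]
OnPath a (c ∷ cs) b q = q ∈[ a , c ] ⊎ OnPath c cs b q

-- The path does not revisit any of its points: each segment meets the rest of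
-- the path only in its end.
IsArc : Point → List Point → Point → Set
IsArc a []       b = a ≢ b
IsArc a (c ∷ cs) b = a ≢ c × IsArc c cs b ×
  (∀ q → q ∈[ a , c ] → OnPath c cs b q → q ≡ c)

record PlanarDrawing {k : ℕ} (G : Graph k) : Set where
  open Graph G
  field
    pos     : Vertex → Point
    freeEnd : Fin k → Point
    bends   : Edge → List Point

  start : Edge → Point
  start = [ (λ e → pos (proj₁ (ends e))) , (λ d → pos (attach d)) ]′

  stop : Edge → Point
  stop = [ (λ e → pos (proj₂ (ends e))) , freeEnd ]′

  On : Edge → Point → Set
  On e = OnPath (start e) (bends e) (stop e)

  -- The point set of the drawing without the dangling edges.
  Drawn : Point → Set
  Drawn q = (∃[ v ] q ≡ pos v) ⊎ (∃[ e ] On (inj₁ e) q)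

  -- The outer face is the unbounded component of the complement of that set:
  -- arbitrarily distant points can be reached without meeting the drawing.
  OuterFace : Point → Set
  OuterFace q = ∀ B → ∃[ r ] ∃[ cs ]
    B ℚ.< ∣ proj₁ r ∣ ℚ.⊔ ∣ proj₂ r ∣ × (∀ p → OnPath q cs r p → ¬ Drawn p)

  field
    pos-injective : Injective _≡_ _≡_ pos
    arcs          : ∀ e → IsArc (start e) (bends e) (stop e)
    vertexOnEdge  : ∀ v e → On e (pos v) → Incident v e
    noCrossing    : ∀ e e′ → e ≢ e′ → ∀ q → On e q → On e′ q → ∃[ v ] q ≡ pos v
    danglingOuter : ∀ d q → On (inj₂ d) q → q ≢ pos (attach d) → OuterFace q

Planar : ∀ {k} → Gadget k → Set
Planar G = PlanarDrawing (Gadget.graph G)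

{-# OPTIONS --safe #-}
module Submission where

-- The Hamming weight W of the inputs is computed by a binary counter laid out as
-- a binary tree: row 0 holds the inputs, and row h + 1 is a path of full adders
-- that combine the carries of row h in pairs, sending one bit along the row and
-- one carry to the row above. A carry stands for two carries of the row below, so
-- the bit leaving row h + 1 is bit h of W. To the right of the counter stands a
-- second binary tree of the same shape. Its row h + 1 receives bit h of W
-- and each of its nodes sends a token coming from above to the left or to the right
-- child according to that bit. So the token reaches exactly leaf W, which contributes
-- the value of F on inputs of weight W. The bits are forced, hence the sum over
-- assignments has one nonzero term. An adder or switch has five edges, a row is a
-- straight line, and the trees have O(k) nodes.

open import Defs
open import Algebra.Bundles using (CommutativeRing)
open import Data.Nat as ℕ using (ℕ; zero; suc; _+_; _*_; _∸_; _^_; _≤_; _<_; z≤n; s≤s; s≤s⁻¹; ⌊_/2⌋; _≡ᵇ_; _<?_; NonZero)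
import Data.Nat.Properties as ℕₚ
import Data.Nat.Coprimality as Coprimality
import Data.Nat.Solver as ℕSolver
open import Data.Integer as ℤ using (ℤ; -[1+_]; +_)
import Data.Integer.Properties as ℤₚ
open import Data.Rational as ℚ using (ℚ; mkℚ; 0ℚ; 1ℚ; ∣_∣)
import Data.Rational.Properties as ℚₚ
open import Data.Rational.Solver using (module +-*-Solver)
open import Algebra.Properties.Group ℚₚ.+-0-group using (∙-cancelˡ) renaming (⁻¹-involutive to neg-involutive)
open import Data.Bool using (Bool; T; true; false; not; _∧_; _∨_; _xor_; if_then_else_)
import Data.Bool.Properties as Boolₚ
open import Data.Bool.ListAction using (all)
open import Data.Fin as Fin using (Fin; zero; suc; toℕ)
import Data.Fin.Properties as Finₚ
open import Data.Fin.Permutation as Perm using (_⟨$⟩ʳ_; _∘ₚ_; lift₀; transpose)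
open import Data.List as List using (List; []; _∷_; length; map; filter; allFin; upTo; _++_)
import Data.List.Properties as Listₚ
open import Data.List.Membership.Propositional using (_∈_; _∉_)
open import Data.List.Membership.Propositional.Properties
import Data.List.Membership.DecPropositional as DecMembership
open import Data.List.Relation.Unary.Any as Any using (here; there)
open import Data.List.Relation.Unary.Any.Properties using (lookup-index)
open import Data.List.Relation.Unary.All as All using ()
import Data.List.Relation.Unary.All.Properties as Allₚ
open import Data.List.Relation.Unary.AllPairs using (_∷_)
open import Data.List.Relation.Unary.Unique.Propositional using (Unique)
import Data.List.Relation.Unary.Unique.Propositional.Properties as Uniqueₚ
open import Data.Vec as Vec using (Vec; []; _∷_; lookup; tabulate; fromList)
import Data.Vec.Properties as Vecₚ
open import Data.Product using (∃-syntax; _×_; _,_; proj₁; proj₂)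
import Data.Product.Properties as Productₚ
open import Data.Sum as Sum using (_⊎_; inj₁; inj₂; [_,_]′)
import Data.Sum.Properties as Sumₚ
open import Data.Empty using (⊥; ⊥-elim)
open import Function using (_∘_; Injective; _⇔_; mk⇔; Equivalence)
open import Relation.Nullary using (¬_; Dec; yes; no; does)
open import Relation.Nullary.Decidable using (_×-dec_; _⊎-dec_; map′; T?)
open import Relation.Binary using (DecidableEquality)
open import Relation.Binary.Definitions using (Tri; tri<; tri≈; tri>)
import Relation.Binary.Reasoning.Setoid as ≈-Reasoning
open import Relation.Binary.PropositionalEquality using (_≡_; _≢_; refl; sym; trans; cong; cong₂; subst; subst₂; module ≡-Reasoning)

-- Sums, products and gadgets

module ℂₚ = CommutativeRing ℂ-commutativeRing

sumBool-cong : ∀ m {f g : Vec Bool m → ℂ} → (∀ σ → f σ ≈ℂ g σ) → sumBool m f ≈ℂ sumBool m g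
sumBool-cong zero    f≈g = f≈g []
sumBool-cong (suc m) f≈g = ℂₚ.+-cong (sumBool-cong m (f≈g ∘ (false ∷_))) (sumBool-cong m (f≈g ∘ (true ∷_)))

sumBool-0 : ∀ m {f : Vec Bool m → ℂ} → (∀ σ → f σ ≈ℂ 0ℂ) → sumBool m f ≈ℂ 0ℂ
sumBool-0 zero    f≈0 = f≈0 []
sumBool-0 (suc m) f≈0 =
  ℂₚ.trans (ℂₚ.+-cong (sumBool-0 m (f≈0 ∘ (false ∷_))) (sumBool-0 m (f≈0 ∘ (true ∷_)))) (ℂₚ.+-identityˡ 0ℂ)

sumBool-single : ∀ {m} (σ : Vec Bool m) {f : Vec Bool m → ℂ} → (∀ τ → τ ≢ σ → f τ ≈ℂ 0ℂ) → sumBool m f ≈ℂ f σ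
sumBool-single []          f≈0 = ℂₚ.refl
sumBool-single {suc m} (false ∷ σ) f≈0 = ℂₚ.trans
  (ℂₚ.+-cong (sumBool-single σ (λ τ τ≢ → f≈0 _ (τ≢ ∘ Vecₚ.∷-injectiveʳ))) (sumBool-0 m (λ τ → f≈0 (_ ∷ τ) λ ())))
  (ℂₚ.+-identityʳ _)
sumBool-single {suc m} (true ∷ σ) f≈0 = ℂₚ.trans
  (ℂₚ.+-cong (sumBool-0 m (λ τ → f≈0 (_ ∷ τ) λ ())) (sumBool-single σ (λ τ τ≢ → f≈0 _ (τ≢ ∘ Vecₚ.∷-injectiveʳ))))
  (ℂₚ.+-identityˡ _)

prodFin-cong : ∀ {n} {f g : Fin n → ℂ} → (∀ i → f i ≈ℂ g i) → prodFin f ≈ℂ prodFin g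
prodFin-cong {zero}  f≈g = ℂₚ.refl
prodFin-cong {suc n} f≈g = ℂₚ.*-cong (f≈g zero) (prodFin-cong (f≈g ∘ suc))

prodFin-0 : ∀ {n} (i : Fin n) {f : Fin n → ℂ} → f i ≈ℂ 0ℂ → prodFin f ≈ℂ 0ℂ
prodFin-0 zero    fi≈0 = ℂₚ.trans (ℂₚ.*-congʳ fi≈0) (ℂₚ.zeroˡ _)
prodFin-0 (suc i) fi≈0 = ℂₚ.trans (ℂₚ.*-congˡ (prodFin-0 i fi≈0)) (ℂₚ.zeroʳ _)

prodFin-1 : ∀ {n} {f : Fin n → ℂ} → (∀ i → f i ≈ℂ 1ℂ) → prodFin f ≈ℂ 1ℂ
prodFin-1 {zero}  f≈1 = ℂₚ.refl
prodFin-1 {suc n} f≈1 = ℂₚ.trans (ℂₚ.*-cong (f≈1 zero) (prodFin-1 (f≈1 ∘ suc))) (ℂₚ.*-identityˡ 1ℂ)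

prodFin-single : ∀ {n} (i : Fin n) {f : Fin n → ℂ} → (∀ j → j ≢ i → f j ≈ℂ 1ℂ) → prodFin f ≈ℂ f i
prodFin-single zero    f≈1 = ℂₚ.trans (ℂₚ.*-congˡ (prodFin-1 (λ j → f≈1 (suc j) λ ()))) (ℂₚ.*-identityʳ _)
prodFin-single (suc i) f≈1 = ℂₚ.trans
  (ℂₚ.*-cong (f≈1 zero λ ()) (prodFin-single i (λ j j≢i → f≈1 (suc j) (j≢i ∘ Finₚ.suc-injective))))
  (ℂₚ.*-identityˡ _)

lookup-injective : ∀ {A : Set} {xs : List A} → Unique xs → ∀ {i j} → List.lookup xs i ≡ List.lookup xs j → i ≡ j
lookup-injective (x∉ ∷ xs!) {zero}  {zero}  eq = refl
lookup-injective (x∉ ∷ xs!) {zero}  {suc j} eq = ⊥-elim (All.lookup x∉ (∈-lookup j) eq)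
lookup-injective (x∉ ∷ xs!) {suc i} {zero}  eq = ⊥-elim (All.lookup x∉ (∈-lookup i) (sym eq))
lookup-injective (x∉ ∷ xs!) {suc i} {suc j} eq = cong suc (lookup-injective xs! eq)

unique-⊆-length : ∀ {A : Set} {xs ys : List A} → Unique xs → (∀ {x} → x ∈ xs → x ∈ ys) → length xs ≤ length ys
unique-⊆-length {xs = xs} {ys} xs! xs⊆ys = Finₚ.injective⇒≤ {f = λ i → Any.index (xs⊆ys (∈-lookup {xs = xs} i))}
  λ {i} {j} eq → lookup-injective xs! (begin
    List.lookup xs i                                     ≡⟨ lookup-index (xs⊆ys (∈-lookup i)) ⟩
    List.lookup ys (Any.index (xs⊆ys (∈-lookup i)))      ≡⟨ cong (List.lookup ys) eq ⟩
    List.lookup ys (Any.index (xs⊆ys (∈-lookup j)))      ≡⟨ lookup-index (xs⊆ys (∈-lookup j)) ⟨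
    List.lookup xs j                                     ∎)
  where open ≡-Reasoning

0𝔸 1𝔸 : 𝔸
-- The polynomials are X for 0 and X - 1 for 1; their values compute to 0 at every index.
0𝔸 = mk𝔸 0ℂ ((ℤ.+ 0 ∷ ℤ.+ 1 ∷ []) , there (here λ ()) ,
  (mk≈ℝ (λ ε 0<ε → 0 , λ _ _ → 0<ε) +i mk≈ℝ (λ ε 0<ε → 0 , λ _ _ → 0<ε)))
1𝔸 = mk𝔸 1ℂ ((ℤ.-[1+ 0 ] ∷ ℤ.+ 1 ∷ []) , there (here λ ()) ,
  (mk≈ℝ (λ ε 0<ε → 0 , λ _ _ → 0<ε) +i mk≈ℝ (λ ε 0<ε → 0 , λ _ _ → 0<ε)))

-- Nodes and links carry structured names; the indices that `Graph` asks for are positions in the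
-- duplicate-free lists `nodes` and `links`.
record Network : Set₁ where
  field
    {Node Link}  : Set
    _≟ⁿ_         : DecidableEquality Node
    _≟ˡ_         : DecidableEquality Link
    nodes        : List Node
    nodes!       : Unique nodes
    links        : List Link
    links!       : Unique links
    src tgt      : Link → Node
    src∈         : ∀ {κ} → κ ∈ links → src κ ∈ nodes
    tgt∈         : ∀ {κ} → κ ∈ links → tgt κ ∈ nodes
    parallel     : ∀ κ κ′ → src κ ≡ src κ′ → tgt κ ≡ tgt κ′ → κ ≡ κ′
    antiparallel : ∀ κ κ′ → src κ ≡ tgt κ′ → tgt κ ≢ src κ′
    {k}          : ℕ
    place        : Fin k → Node
    place∈       : ∀ j → place j ∈ nodes
    place-inj    : Injective _≡_ _≡_ place

  n m : ℕ
  n = length nodes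
  m = length links

  node : Fin n → Node
  node = List.lookup nodes

  link : Fin m → Link
  link = List.lookup links

  node-inj : ∀ {u v} → node u ≡ node v → u ≡ v
  node-inj = lookup-injective nodes!

  srcᵛ tgtᵛ : Fin m → Fin n
  srcᵛ e = Any.index (src∈ (∈-lookup {xs = links} e))
  tgtᵛ e = Any.index (tgt∈ (∈-lookup {xs = links} e))

  placeᵛ : Fin k → Fin n
  placeᵛ j = Any.index (place∈ j)

  node-src : ∀ e → node (srcᵛ e) ≡ src (link e)
  node-src e = sym (lookup-index (src∈ (∈-lookup {xs = links} e)))

  node-tgt : ∀ e → node (tgtᵛ e) ≡ tgt (link e)
  node-tgt e = sym (lookup-index (tgt∈ (∈-lookup {xs = links} e)))

  node-place : ∀ j → node (placeᵛ j) ≡ place j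
  node-place j = sym (lookup-index (place∈ j))

  graph : Graph k
  graph = record
    { n = n ; m = m ; ends = λ e → srcᵛ e , tgtᵛ e ; attach = placeᵛ
    -- A loop would be antiparallel to itself.
    ; loopless = λ e s≡t →
        let eq = trans (sym (node-src e)) (trans (cong node s≡t) (node-tgt e))
        in antiparallel (link e) (link e) eq (sym eq)
    ; noParallel = λ e e′ sub → lookup-injective links!
        (same e e′ (sub (srcᵛ e) (inj₁ refl)) (sub (tgtᵛ e) (inj₂ refl)))
    }
    where
    via : ∀ {x y} {u v : Fin n} → node u ≡ x → node v ≡ y → u ≡ v → x ≡ y
    via u v eq = trans (sym u) (trans (cong node eq) v)

    loop : ∀ κ → src κ ≢ tgt κ
    loop κ eq = antiparallel κ κ eq (sym eq)

    same : ∀ e e′ → srcᵛ e ≡ srcᵛ e′ ⊎ srcᵛ e ≡ tgtᵛ e′ → tgtᵛ e ≡ srcᵛ e′ ⊎ tgtᵛ e ≡ tgtᵛ e′ → link e ≡ link e′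
    same e e′ (inj₁ ss) (inj₂ tt) = parallel _ _ (via (node-src e) (node-src e′) ss) (via (node-tgt e) (node-tgt e′) tt)
    same e e′ (inj₂ st) (inj₁ ts) =
      ⊥-elim (antiparallel _ _ (via (node-src e) (node-tgt e′) st) (via (node-tgt e) (node-src e′) ts))
    same e e′ (inj₁ ss) (inj₁ ts) = ⊥-elim (loop (link e) (via (node-src e) (node-tgt e) (trans ss (sym ts))))
    same e e′ (inj₂ st) (inj₂ tt) = ⊥-elim (loop (link e) (via (node-src e) (node-tgt e) (trans st (sym tt))))

  open Graph graph public using (Edge; Incident)

  Touches : Node → Link → Set
  Touches p κ = p ≡ src κ ⊎ p ≡ tgt κ

  touches⇒incident : ∀ v e → Touches (node v) (link e) → Incident v (inj₁ e)
  touches⇒incident v e (inj₁ eq) = inj₁ (node-inj (trans eq (sym (node-src e))))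
  touches⇒incident v e (inj₂ eq) = inj₂ (node-inj (trans eq (sym (node-tgt e))))

  incident⇒touches : ∀ v e → Incident v (inj₁ e) → Touches (node v) (link e)
  incident⇒touches v e (inj₁ eq) = inj₁ (trans (cong node eq) (node-src e))
  incident⇒touches v e (inj₂ eq) = inj₂ (trans (cong node eq) (node-tgt e))

  incident? : ∀ v e → Dec (Incident v e)
  incident? v (inj₁ e) = (v Fin.≟ srcᵛ e) ⊎-dec (v Fin.≟ tgtᵛ e)
  incident? v (inj₂ j) = v Fin.≟ placeᵛ j

  edges : List Edge
  edges = map inj₁ (allFin m) ++ map inj₂ (allFin k)

  edges! : Unique edges
  edges! = Uniqueₚ.++⁺ (Uniqueₚ.map⁺ Sumₚ.inj₁-injective (Uniqueₚ.allFin⁺ m))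
    (Uniqueₚ.map⁺ Sumₚ.inj₂-injective (Uniqueₚ.allFin⁺ k))
    λ (p , q) → case-∈ (∈-map⁻ inj₁ p) (∈-map⁻ inj₂ q)
    where
    case-∈ : ∀ {e} → ∃[ x ] (x ∈ allFin m × e ≡ inj₁ x) → ∃[ y ] (y ∈ allFin k × e ≡ inj₂ y) → ⊥
    case-∈ (_ , _ , refl) (_ , _ , ())

  ∈-edges : ∀ e → e ∈ edges
  ∈-edges (inj₁ e) = ∈-++⁺ˡ (∈-map⁺ inj₁ (∈-allFin e))
  ∈-edges (inj₂ j) = ∈-++⁺ʳ (map inj₁ (allFin m)) (∈-map⁺ inj₂ (∈-allFin j))

  around : Fin n → List Edge
  around v = filter (incident? v) edges

  ∈-around : ∀ v e → e ∈ around v ⇔ Incident v e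
  ∈-around v e = mk⇔ (proj₂ ∘ ∈-filter⁻ (incident? v) {xs = edges}) (∈-filter⁺ (incident? v) (∈-edges e))

  around! : ∀ v → Unique (around v)
  around! v = Uniqueₚ.filter⁺ (incident? v) edges!

  label : Edge → Link ⊎ Node
  label (inj₁ e) = inj₁ (link e)
  label (inj₂ j) = inj₂ (place j)

  label-inj : ∀ {e e′} → label e ≡ label e′ → e ≡ e′
  label-inj {inj₁ _} {inj₁ _} eq = cong inj₁ (lookup-injective links! (Sumₚ.inj₁-injective eq))
  label-inj {inj₂ _} {inj₂ _} eq = cong inj₂ (place-inj (Sumₚ.inj₂-injective eq))

  -- Edges are told apart by their labels, so any list that covers the labels of the edges at `v`
  -- bounds its degree.
  around-length : ∀ v (near : List (Link ⊎ Node)) →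
    (∀ {κ} → κ ∈ links → Touches (node v) κ → inj₁ κ ∈ near) →
    (∀ {j} → node v ≡ place j → inj₂ (place j) ∈ near) →
    length (around v) ≤ length near
  around-length v near f g = subst (_≤ length near) (Listₚ.length-map label (around v))
    (unique-⊆-length (Uniqueₚ.map⁺ label-inj (around! v)) (λ p → sub (∈-map⁻ label p)))
    where
    sub : ∀ {x} → ∃[ e ] (e ∈ around v × x ≡ label e) → x ∈ near
    sub (inj₁ e , p , refl) = f (∈-lookup {xs = links} e) (incident⇒touches v e (proj₂ (∈-filter⁻ (incident? v) {xs = edges} p)))
    sub (inj₂ j , p , refl) = g (trans (cong node (proj₂ (∈-filter⁻ (incident? v) {xs = edges} p))) (node-place j))

  open DecMembership _≟ˡ_ using (_∈?_)

  _≟ᵉ_ : DecidableEquality Edge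
  _≟ᵉ_ = Sumₚ.≡-dec Fin._≟_ Fin._≟_

  -- A vertex function receives a bare vector of bits; `read` turns it back into an assignment, with
  -- default `false` for edges outside the list.
  read : (es : List Edge) → Vec Bool (length es) → Edge → Bool
  read []        []       e = false
  read (e′ ∷ es) (b ∷ bs) e with e ≟ᵉ e′
  ... | yes _ = b
  ... | no  _ = read es bs e

  read-map : ∀ (f : Edge → Bool) {es e} → e ∈ es → read es (Vec.map f (fromList es)) e ≡ f e
  read-map f {e′ ∷ es} {e} e∈ with e ≟ᵉ e′ | e∈
  ... | yes refl | _         = refl
  ... | no e≢    | here e≡   = ⊥-elim (e≢ e≡)
  ... | no e≢    | there e∈′ = read-map f e∈′

  -- Names that are not links of the network count as `false`, so that rules can mention links that
  -- may be absent.
  bits : (Edge → Bool) → Link → Bool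
  bits f κ with κ ∈? links
  ... | yes κ∈ = f (inj₁ (Any.index κ∈))
  ... | no _   = false

  bits-∈ : ∀ f κ {b} → (∀ e → link e ≡ κ → f (inj₁ e) ≡ b) → κ ∈ links → bits f κ ≡ b
  bits-∈ f κ eq κ∈ with κ ∈? links
  ... | yes κ∈′ = eq _ (sym (lookup-index κ∈′))
  ... | no κ∉   = ⊥-elim (κ∉ κ∈)

  bits-∉ : ∀ f κ → κ ∉ links → bits f κ ≡ false
  bits-∉ f κ κ∉ with κ ∈? links
  ... | yes κ∈ = ⊥-elim (κ∉ κ∈)
  ... | no _   = refl

  bits-cong : ∀ {f f′} κ → (∀ e → link e ≡ κ → f (inj₁ e) ≡ f′ (inj₁ e)) → bits f κ ≡ bits f′ κ
  bits-cong κ eq with κ ∈? links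
  ... | yes κ∈ = eq _ (sym (lookup-index κ∈))
  ... | no _   = refl

  AgreeAt : Node → (a a′ : Link → Bool) (d d′ : Fin k → Bool) → Set
  AgreeAt p a a′ d d′ = (∀ κ → Touches p κ → a κ ≡ a′ κ) × (∀ j → p ≡ place j → d j ≡ d′ j)

  -- A system prescribes every link's bit in terms of the other bits at one of
  -- its ends, and gives weights to the assignments that follow the rule.
  record System : Set where
    field
      rule         : (Link → Bool) → (Fin k → Bool) → Link → Bool
      owner        : Link → Node
      owner-end    : ∀ κ → Touches (owner κ) κ
      rule-local   : ∀ κ {a a′ d d′} → AgreeAt (owner κ) a a′ d d′ → rule a d κ ≡ rule a′ d′ κ
      weight       : Node → (Link → Bool) → 𝔸
      weight-local : ∀ p {a a′} → (∀ κ → Touches p κ → a κ ≡ a′ κ) → weight p a ≡ weight p a′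

    -- Each link is tested at its owner only, where all bits that its rule depends on are visible;
    -- the tests at all nodes together say that every link obeys `rule`.
    check : Node → (Link → Bool) → (Fin k → Bool) → Link → Bool
    check p a d κ = not (does (owner κ ≟ⁿ p)) ∨ does (a κ Boolₚ.≟ rule a d κ)

    check-local : ∀ p {a a′ d d′} → AgreeAt p a a′ d d′ → ∀ κ → check p a d κ ≡ check p a′ d′ κ
    check-local p agree κ with owner κ ≟ⁿ p
    ... | no _     = refl
    ... | yes refl = cong₂ (λ b c → does (b Boolₚ.≟ c)) (proj₁ agree κ (owner-end κ)) (rule-local κ agree)

    value-at : Node → (Link → Bool) → (Fin k → Bool) → 𝔸
    value-at p a d = if all (check p a d) links then weight p a else 0𝔸

    value-local : ∀ p {a a′ d d′} → AgreeAt p a a′ d d′ → value-at p a d ≡ value-at p a′ d′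
    value-local p {a} {a′} {d} {d′} agree = cong₂ (λ b w → if b then w else 0𝔸) (all-cong links) (weight-local p (proj₁ agree))
      where
      all-cong : ∀ κs → all (check p a d) κs ≡ all (check p a′ d′) κs
      all-cong []       = refl
      all-cong (κ ∷ κs) = cong₂ _∧_ (check-local p agree κ) (all-cong κs)

    gadget : Gadget k
    gadget = record
      { graph = graph ; N = around ; N-unique = around! ; N-incident = ∈-around
      ; fun = λ v bs → let f = read (around v) bs in value-at (node v) (bits f) (f ∘ inj₂)
      }

    module _ (y : Vec Bool k) where

      assign : Vec Bool m → Edge → Bool
      assign σ = [ lookup σ , lookup y ]′

      factor : Vec Bool m → Fin n → 𝔸
      factor σ v = value-at (node v) (bits (assign σ)) (lookup y)

      -- By locality, a vertex function cannot distinguish the default bits supplied by `read` from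
      -- the bits of the whole assignment.
      signature-factors : Gadget.signature gadget y ≈ℂ sumBool m (λ σ → prodFin λ v → value (factor σ v))
      signature-factors = sumBool-cong m λ σ → prodFin-cong λ v →
        ℂₚ.reflexive (cong value (value-local (node v)
          ( (λ κ t → bits-cong κ λ e e≡ → seen σ v (inj₁ e) (touches⇒incident v e (subst (Touches (node v)) (sym e≡) t)))
          , (λ j p≡ → seen σ v (inj₂ j) (node-inj (trans p≡ (sym (node-place j)))))
          )))
        where
        seen : ∀ σ v e → Incident v e → read (around v) (Vec.map (assign σ) (fromList (around v))) e ≡ assign σ e
        seen σ v e i = read-map (assign σ) (Equivalence.from (∈-around v e) i)

      module _ (a : Link → Bool)
        (a-rule : ∀ {κ} → κ ∈ links → a κ ≡ rule a (lookup y) κ)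
        (a-off  : ∀ {κ} → κ ∉ links → a κ ≡ false)
        (unique : ∀ {a′} → (∀ {κ} → κ ∈ links → a′ κ ≡ rule a′ (lookup y) κ) → (∀ {κ} → κ ∉ links → a′ κ ≡ false) →
                  ∀ {κ} → κ ∈ links → a′ κ ≡ a κ)
        where

        solved : Vec Bool m
        solved = tabulate (a ∘ link)

        bits-solved : ∀ κ → bits (assign solved) κ ≡ a κ
        bits-solved κ with κ ∈? links
        ... | yes κ∈ = trans (Vecₚ.lookup∘tabulate (a ∘ link) (Any.index κ∈)) (cong a (sym (lookup-index κ∈)))
        ... | no κ∉  = sym (a-off κ∉)

        follows : (σ : Vec Bool m) (v : Fin n) → Bool
        follows σ v = all (check (node v) (bits (assign σ)) (lookup y)) links

        check-true : ∀ p a′ d κ → (owner κ ≡ p → a′ κ ≡ rule a′ d κ) → T (check p a′ d κ)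
        check-true p a′ d κ eq with owner κ ≟ⁿ p
        ... | no _   = _
        ... | yes o≡ with a′ κ Boolₚ.≟ rule a′ d κ
        ...   | yes _ = _
        ...   | no ≢  = ⊥-elim (≢ (eq o≡))

        check-sound : ∀ p a′ d κ → owner κ ≡ p → T (check p a′ d κ) → a′ κ ≡ rule a′ d κ
        check-sound p a′ d κ o≡ t with owner κ ≟ⁿ p
        ... | no ≢  = ⊥-elim (≢ o≡)
        ... | yes _ with a′ κ Boolₚ.≟ rule a′ d κ
        ...   | yes eq = eq

        owner∈ : ∀ {κ} → κ ∈ links → owner κ ∈ nodes
        owner∈ {κ} κ∈ with owner κ | owner-end κ
        ... | _ | inj₁ refl = src∈ κ∈
        ... | _ | inj₂ refl = tgt∈ κ∈

        -- Every link is owned by a node of the network, whose test enforces its rule; uniqueness of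
        -- the solution then fixes all bits.
        follows⇒solved : ∀ σ → (∀ v → T (follows σ v)) → σ ≡ solved
        follows⇒solved σ ok = trans (sym (Vecₚ.tabulate∘lookup σ)) (Vecₚ.tabulate-cong λ e → begin
          lookup σ e                  ≡⟨ bits-∈ (assign σ) (link e) (λ e′ eq → cong (lookup σ) (lookup-injective links! eq)) (∈-lookup e) ⟨
          bits (assign σ) (link e)    ≡⟨ unique holds (λ {κ} → bits-∉ (assign σ) κ) (∈-lookup e) ⟩
          a (link e)                  ∎)
          where
          open ≡-Reasoning
          holds : ∀ {κ} → κ ∈ links → bits (assign σ) κ ≡ rule (bits (assign σ)) (lookup y) κ
          holds {κ} κ∈ = check-sound _ _ _ κ (lookup-index (owner∈ κ∈))
            (All.lookup (Allₚ.all⁺ _ links (ok (Any.index (owner∈ κ∈)))) κ∈)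

        factor-0 : ∀ σ → σ ≢ solved → ∃[ v ] factor σ v ≡ 0𝔸
        factor-0 σ σ≢ with Finₚ.¬∀⟶∃¬ n (T ∘ follows σ) (λ v → T? (follows σ v)) (σ≢ ∘ follows⇒solved σ)
        ... | v , ¬ok = v , cong (λ b → if b then weight (node v) (bits (assign σ)) else 0𝔸) (T-false ¬ok)
          where
          T-false : ∀ {b} → ¬ T b → b ≡ false
          T-false {false} _  = refl
          T-false {true}  ¬t = ⊥-elim (¬t _)

        factor-solved : ∀ v → factor solved v ≡ weight (node v) a
        factor-solved v = trans
          (value-local (node v) {d = lookup y} ((λ κ _ → bits-solved κ) , λ _ _ → refl))
          (cong (λ b → if b then weight (node v) a else 0𝔸)
            (Equivalence.to Boolₚ.T-≡ (Allₚ.all⁻ (check (node v) a (lookup y))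
              (All.tabulate λ {κ} κ∈ → check-true (node v) a (lookup y) κ λ _ → a-rule κ∈))))

        -- Every assignment but `solved` breaks a rule at some vertex and contributes 0; for
        -- `solved` only the factor at `p` can differ from 1.
        signature-weight : ∀ {p} → p ∈ nodes → (∀ p′ → p′ ≢ p → value (weight p′ a) ≈ℂ 1ℂ) →
          Gadget.signature gadget y ≈ℂ value (weight p a)
        signature-weight {p} p∈ others = begin
          Gadget.signature gadget y                                  ≈⟨ signature-factors ⟩
          sumBool m (λ σ → prodFin λ v → value (factor σ v))         ≈⟨ sumBool-single solved (λ σ σ≢ →
                                                                         let v , eq = factor-0 σ σ≢ in
                                                                         prodFin-0 v (ℂₚ.reflexive (cong value eq))) ⟩
          prodFin (λ v → value (factor solved v))                    ≈⟨ prodFin-cong (λ v → ℂₚ.reflexive (cong value (factor-solved v))) ⟩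
          prodFin (λ v → value (weight (node v) a))                  ≈⟨ prodFin-single (Any.index p∈) (λ v v≢ →
                                                                         others (node v) λ eq → v≢ (node-inj (trans eq (lookup-index p∈)))) ⟩
          value (weight (node (Any.index p∈)) a)                     ≡⟨ cong (λ p → value (weight p a)) (lookup-index p∈) ⟨
          value (weight p a)                                         ∎
          where open ≈-Reasoning ℂₚ.setoid

-- The counter

double : ℕ → ℕ
double zero    = zero
double (suc n) = suc (suc (double n))

half-double : ∀ n → ⌊ double n /2⌋ ≡ n
half-double zero    = refl
half-double (suc n) = cong suc (half-double n)

-- Negative columns hold the counter, the others the tree that routes the token.
Pt : Set
Pt = ℤ × ℕ

data Link : Set where
  up across : Pt → Link

-- On all of ℤ, `halve` is division by 2 rounded down, since -(1 + i) goes to -(1 + ⌊i/2⌋). It keeps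
-- the two sides of the array apart and is monotone, which the drawing relies on.
halve right left : ℤ → ℤ
halve (+ i)    = + ⌊ i /2⌋
halve -[1+ i ] = -[1+ ⌊ i /2⌋ ]

right (+ i)        = + suc i
right -[1+ zero ]  = + 0
right -[1+ suc i ] = -[1+ i ]

left (+ zero)   = -[1+ 0 ]
left (+ suc i)  = + i
left -[1+ i ]   = -[1+ suc i ]

right-left : ∀ x → right (left x) ≡ x
right-left (+ zero)  = refl
right-left (+ suc i) = refl
right-left -[1+ i ]  = refl

left-right : ∀ x → left (right x) ≡ x
left-right (+ i)        = refl
left-right -[1+ zero ]  = refl
left-right -[1+ suc i ] = refl

parent : Pt → Pt
parent (x , h) = halve x , suc h

src tgt : Link → Pt
src (up p)     = p
src (across p) = p
tgt (up p)            = parent p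
tgt (across (x , h))  = right x , h

size : ℤ → ℕ
size (+ i)    = i
size -[1+ i ] = i

-- Row h consists of the points with size < 2 ^ (m ∸ h).
In : ℕ → Pt → Set
In m       (x , zero)  = size x < 2 ^ m
In zero    (x , suc h) = ⊥
In (suc m) (x , suc h) = In m (x , h)

in? : ∀ m p → Dec (In m p)
in? m       (x , zero)  = size x <? 2 ^ m
in? zero    (x , suc h) = no λ ()
in? (suc m) (x , suc h) = in? m (x , h)

in-mono : ∀ m {x y} h → size y ≤ size x → In m (x , h) → In m (y , h)
in-mono m       zero    y≤x x<  = ℕₚ.≤-<-trans y≤x x<
in-mono (suc m) (suc h) y≤x x∈ = in-mono m h y≤x x∈

in-size : ∀ m {x} h → In m (x , h) → size x < 2 ^ m
in-size m       zero    p = p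
in-size (suc m) (suc h) p = ℕₚ.<-≤-trans (in-size m h p) (ℕₚ.m≤m+n (2 ^ m) _)

half<⇔ : ∀ i n → (⌊ i /2⌋ < n → i < 2 * n) × (i < 2 * n → ⌊ i /2⌋ < n)
half<⇔ i zero = (λ ()) , λ ()
half<⇔ zero (suc n) = (λ _ → s≤s z≤n) , (λ _ → s≤s z≤n)
half<⇔ (suc zero) (suc n) rewrite ℕₚ.+-suc n (n + 0) = (λ _ → s≤s (s≤s z≤n)) , (λ _ → s≤s z≤n)
half<⇔ (suc (suc i)) (suc n) rewrite ℕₚ.+-suc n (n + 0) with half<⇔ i n
... | f , g = (λ { (s≤s p) → s≤s (s≤s (f p)) }) , (λ { (s≤s (s≤s p)) → s≤s (g p) })

size-halve : ∀ x → size (halve x) ≡ ⌊ size x /2⌋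
size-halve (+ i)    = refl
size-halve -[1+ i ] = refl

in-child : ∀ m {x} h → In m (halve x , suc h) → In m (x , h)
in-child (suc m) {x} zero p rewrite size-halve x = proj₁ (half<⇔ (size x) (2 ^ m)) p
in-child (suc m) (suc h) p = in-child m h p

in-parent : ∀ m {x} h → h < m → In m (x , h) → In m (halve x , suc h)
in-parent (suc m) {x} zero h< p rewrite size-halve x = proj₂ (half<⇔ (size x) (2 ^ m)) p
in-parent (suc m) (suc h) (s≤s h<) p = in-parent m h h< p

out-child : ∀ m h {i} → h < m → ¬ In m (-[1+ i ] , suc h) → ¬ In m (-[1+ double i ] , h)
out-child m h {i} h< i∉ 2i∈ = i∉ (subst (λ n → In m (-[1+ n ] , suc h)) (half-double i) (in-parent m h h< 2i∈))

in-height : ∀ m {x} h → In m (x , h) → h ≤ m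
in-height m       zero    p = z≤n
in-height (suc m) (suc h) p = s≤s (in-height m h p)

in-top : ∀ m {x} → In m (x , m) → size x ≡ 0
in-top zero    {x} p = ℕₚ.n≤0⇒n≡0 (s≤s⁻¹ p)
in-top (suc m) p = in-top m p

-- Row 0 has no horizontal links: its nodes are only inputs and leaves.
Valid : ℕ → Link → Set
Valid m (up p)             = In m p × In m (parent p)
Valid m (across (x , h))   = 0 < h × In m (x , h) × In m (right x , h)

valid? : ∀ m κ → Dec (Valid m κ)
valid? m (up p)           = in? m p ×-dec in? m (parent p)
valid? m (across (x , h)) = (0 <? h) ×-dec in? m (x , h) ×-dec in? m (right x , h)

-- Parity, halving and full adders

toℕᵇ : Bool → ℕ
toℕᵇ b = if b then 1 else 0

odd : ℕ → Bool
odd zero    = false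
odd (suc n) = not (odd n)

half-suc-double : ∀ n → ⌊ suc (double n) /2⌋ ≡ n
half-suc-double zero    = refl
half-suc-double (suc n) = cong suc (half-suc-double n)

half-suc : ∀ n → ⌊ suc n /2⌋ ≡ toℕᵇ (odd n) + ⌊ n /2⌋
half-suc zero          = refl
half-suc (suc zero)    = refl
half-suc (suc (suc n)) rewrite Boolₚ.not-involutive (odd n) =
  trans (cong suc (half-suc n)) (sym (ℕₚ.+-suc _ _))

maj : Bool → Bool → Bool → Bool
maj a b c = if a then b ∨ c else b ∧ c

odd-sum : ∀ a b n → odd (toℕᵇ a + (toℕᵇ b + n)) ≡ a xor (b xor odd n)
odd-sum false false n = refl
odd-sum false true  n = refl
odd-sum true  false n = refl
odd-sum true  true  n = refl

-- A full adder acting on a running count: with incoming bit `odd n`, the number of carries grows by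
-- one exactly if at least two of the three bits are set.
half-sum : ∀ a b n → ⌊ toℕᵇ a + (toℕᵇ b + n) /2⌋ ≡ toℕᵇ (maj a b (odd n)) + ⌊ n /2⌋
half-sum false false n = refl
half-sum false true  n = half-suc n
half-sum true  false n = half-suc n
half-sum true  true  n = refl

-- The rule of a switch in arithmetical form: the token is at child `i` exactly if it is at the
-- parent `⌊ i /2⌋` and the parity of `i` is the bit of that row.
≡ᵇ-halves : ∀ i n → (i ≡ᵇ n) ≡ ((⌊ i /2⌋ ≡ᵇ ⌊ n /2⌋) ∧ (if odd i then odd n else not (odd n)))
≡ᵇ-halves zero zero = refl
≡ᵇ-halves zero (suc zero) = refl
≡ᵇ-halves zero (suc (suc n)) = refl
≡ᵇ-halves (suc zero) zero = refl
≡ᵇ-halves (suc (suc i)) zero = refl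
≡ᵇ-halves (suc zero) (suc zero) = refl
≡ᵇ-halves (suc zero) (suc (suc n)) = refl
≡ᵇ-halves (suc (suc i)) (suc zero) = refl
≡ᵇ-halves (suc (suc i)) (suc (suc n))
  rewrite Boolₚ.not-involutive (odd i) | Boolₚ.not-involutive (odd n) = ≡ᵇ-halves i n

at : ∀ {k} → (Fin k → Bool) → ℕ → Bool
at {zero}  d i       = false
at {suc k} d zero    = d zero
at {suc k} d (suc i) = at (d ∘ suc) i

ones : ∀ {k} → (Fin k → Bool) → ℕ → ℕ
ones {zero}  d i       = 0
ones {suc k} d zero    = toℕᵇ (d zero) + ones (d ∘ suc) 0
ones {suc k} d (suc i) = ones (d ∘ suc) i

ones-step : ∀ {k} (d : Fin k → Bool) i → ones d i ≡ toℕᵇ (at d i) + ones d (suc i)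
ones-step {zero}  d i       = refl
ones-step {suc k} d (suc i) = ones-step (d ∘ suc) i
ones-step {suc zero} d zero = refl
ones-step {suc (suc k)} d zero = refl

toℕᵇ≤1 : ∀ b → toℕᵇ b ≤ 1
toℕᵇ≤1 false = z≤n
toℕᵇ≤1 true  = s≤s z≤n

ones-≤ : ∀ {k} (d : Fin k → Bool) → ones d 0 ≤ k
ones-≤ {zero}  d = z≤n
ones-≤ {suc k} d = ℕₚ.+-mono-≤ (toℕᵇ≤1 (d zero)) (ones-≤ (d ∘ suc))

ones-beyond : ∀ {k} (d : Fin k → Bool) i → k ≤ i → ones d i ≡ 0
ones-beyond {zero}  d i       p       = refl
ones-beyond {suc k} d (suc i) (s≤s p) = ones-beyond (d ∘ suc) i p

module Count {k : ℕ} (d : Fin k → Bool) where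

  -- q h i counts the carries leaving row h in columns i, i + 1, … (the inputs, for
  -- h = 0). Rows run from high columns down to column 0, so q h 0 = ⌊ W / 2 ^ h ⌋.
  q : ℕ → ℕ → ℕ
  q zero    i = ones d i
  q (suc h) i = ⌊ q h (double i) /2⌋

  carry : ℕ → ℕ → Bool
  carry zero    i = at d i
  carry (suc h) i = maj (carry h (double i)) (carry h (suc (double i))) (odd (q h (double (suc i))))

  -- Induction on the rows: the adder in column i of row h + 1 takes two carries of row h, and
  -- `half-sum` with `q h (double (suc i))` as running count gives its own carry.
  q-step : ∀ h i → q h i ≡ toℕᵇ (carry h i) + q h (suc i)
  q-double : ∀ h i → q h (double i) ≡
    toℕᵇ (carry h (double i)) + (toℕᵇ (carry h (suc (double i))) + q h (double (suc i)))

  q-step zero    i = ones-step d i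
  q-step (suc h) i = trans (cong ⌊_/2⌋ (q-double h i)) (half-sum (carry h (double i)) _ (q h (double (suc i))))
  q-double h i = trans (q-step h (double i)) (cong₂ _+_ refl (q-step h (suc (double i))))

  -- There is no input beyond the end of row 0, hence no carry beyond the end of any row. So the
  -- links that a row lacks at its far end may be read as `false`.
  q-beyond : ∀ m h i → k ≤ 2 ^ m → h ≤ m → ¬ In m (-[1+ i ] , h) → q h i ≡ 0
  q-beyond m zero    i k≤ _  i∉ = ones-beyond d i (ℕₚ.≤-trans k≤ (ℕₚ.≮⇒≥ i∉))
  q-beyond m (suc h) i k≤ h< i∉ rewrite q-beyond m h (double i) k≤ (ℕₚ.<⇒≤ h<)
    (out-child m h h< i∉) = refl

  q-in : ∀ m h → k < 2 ^ m → h ≤ m → In m (+ q h 0 , h)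
  q-in m zero    k< _  = ℕₚ.≤-<-trans (ones-≤ d) k<
  q-in m (suc h) k< h< = in-parent m h h< (q-in m h k< (ℕₚ.<⇒≤ h<))

  -- Halving m times exhausts any number below 2 ^ m, so the bits of rows 1 to m describe W
  -- completely.
  q-top : ∀ m → k < 2 ^ m → q m 0 ≡ 0
  q-top m k< = in-top m (q-in m m k< ℕₚ.≤-refl)

-- Adders set the links leaving them; a switch sets the links to its right and below.
owner : Link → Pt
owner (up (+ i , h))       = parent (+ i , h)
owner (up (-[1+ i ] , h))  = -[1+ i ] , h
owner (across p)           = p

-- The rules and their unique solution

module Rules (m : ℕ) {k : ℕ} where

  -- Left of column 0 these are full adders; right of it, a node passes the token
  -- to the child selected by the bit of its row. The top node, in row m, holds the
  -- token from the start.
  rule : (Link → Bool) → (Fin k → Bool) → Link → Bool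
  rule a d (up (-[1+ i ] , zero))      = at d i
  rule a d (up (-[1+ i ] , suc h))     =
    maj (a (up (-[1+ double i ] , h))) (a (up (-[1+ suc (double i) ] , h))) (a (across (left -[1+ i ] , suc h)))
  rule a d (up (+ i , h))              =
    ((suc h ≡ᵇ m) ∨ a (up (parent (+ i , h)))) ∧
    (if odd i then a (across (left (halve (+ i)) , suc h)) else not (a (across (left (halve (+ i)) , suc h))))
  rule a d (across (x , zero))         = false
  rule a d (across (-[1+ i ] , suc h)) =
    a (up (-[1+ double i ] , h)) xor (a (up (-[1+ suc (double i) ] , h)) xor a (across (left -[1+ i ] , suc h)))
  rule a d (across (+ i , suc h))      = a (across (left (+ i) , suc h))

  -- Rules read links that may be missing at the rim; these are fixed to `false`, as in `bits`.
  record Solution (d : Fin k → Bool) (a : Link → Bool) : Set where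
    field
      valid   : ∀ κ → Valid m κ → a κ ≡ rule a d κ
      invalid : ∀ κ → ¬ Valid m κ → a κ ≡ false

  module _ (k< : k < 2 ^ m) (d : Fin k → Bool) where
    open Count d

    -- The intended bits. The token descends through node `q h 0` of row h, and the adder in column
    -- -(1 + i) of row h + 1 passes on the parity of the carries that row h sends from column -(1 +
    -- 2i) outward.
    run : Link → Bool
    run (up (-[1+ i ] , h))         = carry h i
    run (up (+ i , h))              = i ≡ᵇ q h 0
    run (across (x , zero))         = false
    run (across (-[1+ i ] , suc h)) = odd (q h (double i))
    run (across (+ i , suc h))      = odd (q h 0)

    run-left : ∀ h i → run (across (left (+ i) , suc h)) ≡ odd (q h 0)
    run-left h zero    = refl
    run-left h (suc i) = refl

    -- In row m only index 0 exists and `q-top` gives 0, in agreement with the token held there from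
    -- the start.
    token : ∀ h x → In m (x , h) → h ≡ m → (size x ≡ᵇ q h 0) ≡ true
    token h x x∈ refl rewrite in-top m x∈ | q-top m k< = refl

    right-valid : ∀ {i h} → In m (-[1+ i ] , suc h) → Valid m (across (-[1+ i ] , suc h))
    right-valid {zero}  p = s≤s z≤n , p , in-mono m {y = + 0} (suc _) z≤n p
    right-valid {suc i} p = s≤s z≤n , p , in-mono m {y = -[1+ i ]} (suc _) (ℕₚ.n≤1+n i) p

    left-valid : ∀ {i h} → In m (+ i , suc h) → Valid m (across (left (+ i) , suc h))
    left-valid {zero}  p = s≤s z≤n , in-mono m {y = -[1+ 0 ]} (suc _) z≤n p , p
    left-valid {suc i} p = s≤s z≤n , in-mono m {y = + i} (suc _) (ℕₚ.n≤1+n i) p , p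

    odd-beyond : ∀ h i → h < m → ¬ In m (-[1+ i ] , suc h) → odd (q h (double i)) ≡ false
    odd-beyond h i h< i∉ = cong odd (q-beyond m h (double i) (ℕₚ.<⇒≤ k<) (ℕₚ.<⇒≤ h<)
      (out-child m h h< i∉))

    module _ (a : Link → Bool) (on : ∀ κ → Valid m κ → a κ ≡ run κ) (off : ∀ κ → ¬ Valid m κ → a κ ≡ false) where

      adder-on : ∀ h i → h < m → a (across (-[1+ i ] , suc h)) ≡ odd (q h (double i))
      adder-on h i h< with in? m (-[1+ i ] , suc h)
      ... | yes i∈ = on _ (right-valid i∈)
      ... | no i∉  = trans (off _ (i∉ ∘ proj₁ ∘ proj₂)) (sym (odd-beyond h i h< i∉))

      child-on : ∀ h i n → ⌊ n /2⌋ ≡ i → In m (-[1+ i ] , suc h) → a (up (-[1+ n ] , h)) ≡ carry h n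
      child-on h i n refl p = on _ (in-child m {x = -[1+ n ]} h p , p)

      bit-on : ∀ h i → In m (+ i , suc h) → a (across (left (+ i) , suc h)) ≡ odd (q h 0)
      bit-on h i p = trans (on _ (left-valid {i} p)) (run-left h i)

      solution : Solution d a
      solution = record { valid = λ κ v → trans (on κ v) (satisfied κ v) ; invalid = off }
        where
        satisfied : ∀ κ → Valid m κ → run κ ≡ rule a d κ
        satisfied (up (-[1+ i ] , zero))      v = refl
        satisfied (up (-[1+ i ] , suc h)) (p , _)
          rewrite child-on h i (double i) (half-double i) p
                | child-on h i (suc (double i)) (half-suc-double i) p
                | adder-on h (suc i) (in-height m (suc h) p) = refl
        satisfied (up (+ i , h)) (_ , p∈)
          rewrite bit-on h ⌊ i /2⌋ p∈ | ≡ᵇ-halves i (q h 0) with suc h ≡ᵇ m in e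
        -- For children of the top node the parent holds the token by decree; otherwise the parent's
        -- own link from above says whether it does.
        ... | true rewrite token (suc h) (+ ⌊ i /2⌋) p∈ (ℕₚ.≡ᵇ⇒≡ _ _ (subst T (sym e) _)) = refl
        ... | false rewrite on (up (+ ⌊ i /2⌋ , suc h)) (p∈ , in-parent m (suc h) (ℕₚ.≤∧≢⇒< (in-height m (suc h) p∈)
                              (λ h≡m → subst T e (ℕₚ.≡⇒≡ᵇ (suc h) m h≡m))) p∈) = refl
        satisfied (across (x , zero))         v = refl
        satisfied (across (-[1+ i ] , suc h)) (_ , p , _)
          rewrite child-on h i (double i) (half-double i) p
                | child-on h i (suc (double i)) (half-suc-double i) p
                | adder-on h (suc i) (in-height m (suc h) p)
                | q-double h i = odd-sum (carry h (double i)) (carry h (suc (double i))) (q h (double (suc i)))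
        satisfied (across (+ i , suc h)) (_ , p , _) = sym (bit-on h i p)

    module _ {a : Link → Bool} (sol : Solution d a) where
      open Solution sol

      module _ (h : ℕ) (ih : ∀ i → Valid m (up (-[1+ i ] , h)) → a (up (-[1+ i ] , h)) ≡ carry h i) where

        child-unique : ∀ i n → ⌊ n /2⌋ ≡ i → In m (-[1+ i ] , suc h) → a (up (-[1+ n ] , h)) ≡ carry h n
        child-unique i n refl p = ih n (in-child m {x = -[1+ n ]} h p , p)

        -- A row is read from its far left end; j bounds the distance to that end.
        row-unique : ∀ j i → 2 ^ m ≤ i + j → h < m → a (across (-[1+ i ] , suc h)) ≡ odd (q h (double i))
        row-unique j i m≤ h< with in? m (-[1+ i ] , suc h)
        ... | no i∉ = trans (invalid _ (i∉ ∘ proj₁ ∘ proj₂)) (sym (odd-beyond h i h< i∉))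
        row-unique zero    i m≤ h< | yes i∈ =
          ⊥-elim (ℕₚ.<⇒≱ (in-size m (suc h) i∈) (subst (2 ^ m ≤_) (ℕₚ.+-identityʳ i) m≤))
        row-unique (suc j) i m≤ h< | yes i∈
          rewrite valid (across (-[1+ i ] , suc h)) (right-valid i∈)
                | child-unique i (double i) (half-double i) i∈
                | child-unique i (suc (double i)) (half-suc-double i) i∈
                | row-unique j (suc i) (subst (2 ^ m ≤_) (ℕₚ.+-suc i j) m≤) h<
                | q-double h i
                = sym (odd-sum (carry h (double i)) (carry h (suc (double i))) (q h (double (suc i))))

      -- Induction upwards: the carries of row h fix the bits running along row h + 1, and both
      -- together fix the carries of row h + 1.
      carry-unique : ∀ h i → Valid m (up (-[1+ i ] , h)) → a (up (-[1+ i ] , h)) ≡ carry h i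
      adder-unique : ∀ h → h < m → ∀ i → a (across (-[1+ i ] , suc h)) ≡ odd (q h (double i))

      carry-unique zero    i v = valid _ v
      carry-unique (suc h) i v@(p , _)
        rewrite valid (up (-[1+ i ] , suc h)) v | child-unique h (carry-unique h) i (double i) (half-double i) p
              | child-unique h (carry-unique h) i (suc (double i)) (half-suc-double i) p
              | adder-unique h (in-height m (suc h) p) (suc i) = refl

      -- From any column, 2 ^ m steps outward lead past the end of the row.
      adder-unique h h< i = row-unique h (carry-unique h) (2 ^ m) i (ℕₚ.m≤n+m (2 ^ m) i) h<

      bit-unique : ∀ h i → In m (+ i , suc h) → a (across (left (+ i) , suc h)) ≡ odd (q h 0)
      bit-unique h zero    p = adder-unique h (in-height m (suc h) p) 0
      bit-unique h (suc i) p = trans (valid _ (left-valid {suc i} p))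
        (bit-unique h i (in-mono m (suc h) (ℕₚ.n≤1+n i) p))

      -- Induction downwards from the top, with j the number of rows above row h: the token at the
      -- parent and the bit of its row are already known.
      token-unique : ∀ j h → h + j ≡ m → ∀ i → Valid m (up (+ i , h)) → a (up (+ i , h)) ≡ (i ≡ᵇ q h 0)
      token-unique zero h refl i (_ , p∈) = ⊥-elim (ℕₚ.1+n≰n (subst (suc h ≤_) (ℕₚ.+-identityʳ h) (in-height m (suc h) p∈)))
      token-unique (suc j) h eq i (i∈ , p∈)
        rewrite valid (up (+ i , h)) (i∈ , p∈) | bit-unique h ⌊ i /2⌋ p∈ | ≡ᵇ-halves i (q h 0) with suc h ≡ᵇ m in e
      ... | true rewrite token (suc h) (+ ⌊ i /2⌋) p∈ (ℕₚ.≡ᵇ⇒≡ _ _ (subst T (sym e) _)) = refl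
      ... | false rewrite token-unique j (suc h) (trans (sym (ℕₚ.+-suc h j)) eq) ⌊ i /2⌋
        (p∈ , in-parent m (suc h) (ℕₚ.≤∧≢⇒< (in-height m (suc h) p∈)
           (λ h≡m → subst T e (ℕₚ.≡⇒≡ᵇ (suc h) m h≡m))) p∈) = refl

      unique : ∀ κ → Valid m κ → a κ ≡ run κ
      unique (up (-[1+ i ] , h))         v           = carry-unique h i v
      unique (up (+ i , h))              v           = token-unique (m ∸ h) h (ℕₚ.m+[n∸m]≡n (in-height m h (proj₁ v))) i v
      unique (across (x , zero))         (() , _)
      unique (across (-[1+ i ] , suc h)) (_ , p , _) = adder-unique h (in-height m (suc h) p) i
      unique (across (+ i , suc h))      (_ , _ , p) = bit-unique h (suc i) p

-- The nodes and links

columns : ℕ → List ℤ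
columns w = map +_ (upTo w) ++ map -[1+_] (upTo w)

∈-columns⁺ : ∀ {w} x → size x < w → x ∈ columns w
∈-columns⁺ (+ i)    i<w = ∈-++⁺ˡ (∈-map⁺ +_ (∈-upTo⁺ i<w))
∈-columns⁺ -[1+ i ] i<w = ∈-++⁺ʳ (map +_ (upTo _)) (∈-map⁺ -[1+_] (∈-upTo⁺ i<w))

∈-columns⁻ : ∀ {w x} → x ∈ columns w → size x < w
∈-columns⁻ {w} x∈ with ∈-++⁻ (map +_ (upTo w)) x∈
... | inj₁ p with ∈-map⁻ +_ p
...   | i , i∈ , refl = ∈-upTo⁻ i∈
∈-columns⁻ {w} x∈ | inj₂ p with ∈-map⁻ -[1+_] p
... | i , i∈ , refl = ∈-upTo⁻ i∈

columns! : ∀ w → Unique (columns w)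
columns! w = Uniqueₚ.++⁺ (Uniqueₚ.map⁺ ℤₚ.+-injective (Uniqueₚ.upTo⁺ w))
  (Uniqueₚ.map⁺ ℤₚ.-[1+-injective (Uniqueₚ.upTo⁺ w)) disjoint
  where
  disjoint : ∀ {x} → x ∈ map +_ (upTo w) × x ∈ map -[1+_] (upTo w) → ⊥
  disjoint (p , q) with ∈-map⁻ +_ p | ∈-map⁻ -[1+_] q
  ... | _ , _ , refl | _ , _ , ()

length-columns : ∀ w → length (columns w) ≡ w + w
length-columns w = trans (Listₚ.length-++ (map +_ (upTo w))) (cong₂ _+_
  (trans (Listₚ.length-map +_ (upTo w)) (Listₚ.length-upTo w))
  (trans (Listₚ.length-map -[1+_] (upTo w)) (Listₚ.length-upTo w)))

raise : Pt → Pt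
raise (x , h) = x , suc h

row : ℕ → List Pt
row w = map (_, 0) (columns w)

points : ℕ → List Pt
points zero    = row 1
points (suc m) = row (2 ^ suc m) ++ map raise (points m)

∈-row⁻ : ∀ w {p} → p ∈ row w → ∃[ x ] (size x < w × p ≡ (x , 0))
∈-row⁻ w p∈ with ∈-map⁻ (_, 0) p∈
... | x , x∈ , refl = x , ∈-columns⁻ {w} x∈ , refl

∈-points⁺ : ∀ m p → In m p → p ∈ points m
∈-points⁺ zero    (x , zero)  x< = ∈-map⁺ (_, 0) (∈-columns⁺ {1} x x<)
∈-points⁺ (suc m) (x , zero)  x< = ∈-++⁺ˡ (∈-map⁺ (_, 0) (∈-columns⁺ {2 ^ suc m} x x<))
∈-points⁺ (suc m) (x , suc h) p  = ∈-++⁺ʳ (row (2 ^ suc m)) (∈-map⁺ raise (∈-points⁺ m (x , h) p))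

∈-points⁻ : ∀ m {p} → p ∈ points m → In m p
∈-points⁻ zero p∈ with ∈-row⁻ 1 p∈
... | _ , x< , refl = x<
∈-points⁻ (suc m) p∈ with ∈-++⁻ (row (2 ^ suc m)) p∈
... | inj₁ p∈row with ∈-row⁻ (2 ^ suc m) p∈row
...   | _ , x< , refl = x<
∈-points⁻ (suc m) p∈ | inj₂ p∈up with ∈-map⁻ raise p∈up
... | _ , q∈ , refl = ∈-points⁻ m q∈

row! : ∀ w → Unique (row w)
row! w = Uniqueₚ.map⁺ (cong proj₁) (columns! w)

points! : ∀ m → Unique (points m)
points! zero    = row! 1
points! (suc m) = Uniqueₚ.++⁺ (row! (2 ^ suc m)) (Uniqueₚ.map⁺ raise-injective (points! m)) disjoint
  where
  raise-injective : ∀ {p p′} → raise p ≡ raise p′ → p ≡ p′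
  raise-injective refl = refl
  disjoint : ∀ {p} → p ∈ row (2 ^ suc m) × p ∈ map raise (points m) → ⊥
  disjoint (a , b) with ∈-row⁻ (2 ^ suc m) a | ∈-map⁻ raise b
  ... | _ , _ , refl | _ , _ , ()

length-row : ∀ w → length (row w) ≡ w + w
length-row w = trans (Listₚ.length-map (_, 0) (columns w)) (length-columns w)

-- The rows have 2, 4, ..., 2 * 2 ^ m nodes, a geometric series with sum less than 4 * 2 ^ m.
length-points : ∀ m → length (points m) ≤ 4 * 2 ^ m
length-points zero    = s≤s (s≤s z≤n)
length-points (suc m) = begin
  length (row (2 ^ suc m) ++ map raise (points m))          ≡⟨ Listₚ.length-++ (row (2 ^ suc m)) ⟩
  length (row (2 ^ suc m)) + length (map raise (points m))  ≡⟨ cong₂ _+_ (length-row (2 ^ suc m)) (Listₚ.length-map raise (points m)) ⟩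
  2 ^ suc m + 2 ^ suc m + length (points m)                 ≤⟨ ℕₚ.+-monoʳ-≤ (2 ^ suc m + 2 ^ suc m) (length-points m) ⟩
  2 ^ suc m + 2 ^ suc m + 4 * 2 ^ m                         ≡⟨ double-up (2 ^ m) ⟩
  4 * 2 ^ suc m                                             ∎
  where
  open ℕₚ.≤-Reasoning
  double-up : ∀ n → 2 * n + 2 * n + 4 * n ≡ 4 * (2 * n)
  double-up = solve 1 (λ n → con 2 :* n :+ con 2 :* n :+ con 4 :* n := con 4 :* (con 2 :* n)) refl
    where open ℕSolver.+-*-Solver

_≟ᵖ_ : DecidableEquality Pt
_≟ᵖ_ = Productₚ.≡-dec ℤ._≟_ ℕₚ._≟_

up-injective : ∀ {p p′} → up p ≡ up p′ → p ≡ p′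
up-injective refl = refl

across-injective : ∀ {p p′} → across p ≡ across p′ → p ≡ p′
across-injective refl = refl

_≟ᵏ_ : DecidableEquality Link
up p     ≟ᵏ up p′     = map′ (cong up) up-injective (p ≟ᵖ p′)
across p ≟ᵏ across p′ = map′ (cong across) across-injective (p ≟ᵖ p′)
up p     ≟ᵏ across p′ = no λ ()
across p ≟ᵏ up p′     = no λ ()

candidates links : ℕ → List Link
candidates m = map up (points m) ++ map across (points m)
links m = filter (valid? m) (candidates m)

links! : ∀ m → Unique (links m)
links! m = Uniqueₚ.filter⁺ (valid? m) (Uniqueₚ.++⁺ (Uniqueₚ.map⁺ up-injective (points! m))
  (Uniqueₚ.map⁺ across-injective (points! m)) disjoint)
  where
  disjoint : ∀ {κ} → κ ∈ map up (points m) × κ ∈ map across (points m) → ⊥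
  disjoint (a , b) with ∈-map⁻ up a | ∈-map⁻ across b
  ... | _ , _ , refl | _ , _ , ()

valid-src : ∀ m κ → Valid m κ → In m (src κ)
valid-src m (up _)     (p , _)     = p
valid-src m (across _) (_ , p , _) = p

valid-tgt : ∀ m κ → Valid m κ → In m (tgt κ)
valid-tgt m (up _)     (_ , p)     = p
valid-tgt m (across _) (_ , _ , p) = p

∈-links⁺ : ∀ m κ → Valid m κ → κ ∈ links m
∈-links⁺ m κ v = ∈-filter⁺ (valid? m) (candidate κ (∈-points⁺ m (src κ) (valid-src m κ v))) v
  where
  candidate : ∀ κ → src κ ∈ points m → κ ∈ candidates m
  candidate (up p)     p∈ = ∈-++⁺ˡ (∈-map⁺ up p∈)
  candidate (across p) p∈ = ∈-++⁺ʳ (map up (points m)) (∈-map⁺ across p∈)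

∈-links⁻ : ∀ m {κ} → κ ∈ links m → Valid m κ
∈-links⁻ m κ∈ = proj₂ (∈-filter⁻ (valid? m) {xs = candidates m} κ∈)

right-right≢ : ∀ x → x ≢ right (right x)
right-right≢ (+ i)            eq = ℕₚ.<⇒≢ (ℕₚ.≤-trans (ℕₚ.n<1+n i) (ℕₚ.n≤1+n _)) (ℤₚ.+-injective eq)
right-right≢ -[1+ zero ]      ()
right-right≢ -[1+ suc zero ]  ()
right-right≢ -[1+ suc (suc i) ] ()

parallel : ∀ κ κ′ → src κ ≡ src κ′ → tgt κ ≡ tgt κ′ → κ ≡ κ′
parallel (up p)     (up _)     refl _ = refl
parallel (across p) (across _) refl _ = refl
parallel (up (x , h)) (across _) refl eq = ⊥-elim (ℕₚ.1+n≢n (cong proj₂ eq))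
parallel (across (x , h)) (up _) refl eq = ⊥-elim (ℕₚ.1+n≢n (sym (cong proj₂ eq)))

-- Up links raise the height and across links move right, so following two links never leads back to
-- the start.
antiparallel : ∀ κ κ′ → src κ ≡ tgt κ′ → tgt κ ≢ src κ′
antiparallel (up p)     (up (x , h))     refl eq = ℕₚ.<⇒≢ (ℕₚ.≤-trans (ℕₚ.n<1+n h) (ℕₚ.n≤1+n _)) (sym (cong proj₂ eq))
antiparallel (across p) (across (x , h)) refl eq = right-right≢ x (sym (cong proj₁ eq))
antiparallel (up p) (across (x , h)) refl eq = ℕₚ.1+n≢n (cong proj₂ eq)
antiparallel (across p) (up (x , h)) refl eq = ℕₚ.1+n≢n (cong proj₂ eq)

childˡ childʳ : ℤ → ℤ
childˡ (+ i)    = + double i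
childˡ -[1+ i ] = -[1+ double i ]
childʳ (+ i)    = + suc (double i)
childʳ -[1+ i ] = -[1+ suc (double i) ]

halves : ∀ n → n ≡ double ⌊ n /2⌋ ⊎ n ≡ suc (double ⌊ n /2⌋)
halves zero          = inj₁ refl
halves (suc zero)    = inj₂ refl
halves (suc (suc n)) = Sum.map (cong (λ i → suc (suc i))) (cong (λ i → suc (suc i))) (halves n)

child : ∀ x → x ≡ childˡ (halve x) ⊎ x ≡ childʳ (halve x)
child (+ i)    = Sum.map (cong (λ i → + i)) (cong (λ i → + i)) (halves i)
child -[1+ i ] = Sum.map (cong -[1+_]) (cong -[1+_]) (halves i)

-- All names of links that can touch a node, valid or not. The five entries above row 0 are the
-- source of the arity bound.
near : Pt → List Link
near (x , zero)  = up (x , 0) ∷ []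
near (x , suc h) = up (x , suc h) ∷ across (x , suc h) ∷ across (left x , suc h) ∷
                     up (childˡ x , h) ∷ up (childʳ x , h) ∷ []

∈-near : ∀ m κ {p} → Valid m κ → p ≡ src κ ⊎ p ≡ tgt κ → κ ∈ near p
∈-near m (up (x , zero))  v (inj₁ refl) = here refl
∈-near m (up (x , suc h)) v (inj₁ refl) = here refl
∈-near m (up (x , h))     v (inj₂ refl) with child x
... | inj₁ eq = there (there (there (here (cong (λ x → up (x , h)) eq))))
... | inj₂ eq = there (there (there (there (here (cong (λ x → up (x , h)) eq)))))
∈-near m (across (x , suc h)) v (inj₁ refl) = there (here refl)
∈-near m (across (x , suc h)) v (inj₂ refl) = there (there (here (cong (λ x → across (x , suc h)) (sym (left-right x)))))

-- The first inequality is strict because the weights of k + 1 inputs take k + 2 values, each with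
-- its own leaf.
power-above : ∀ k → ∃[ m ] (suc k < 2 ^ m × 2 ^ m ≤ 2 * suc k)
power-above zero    = 1 , s≤s (s≤s z≤n) , ℕₚ.≤-refl
power-above (suc k) with power-above k
... | m , k< , ≤2k with ℕₚ.m≤n⇒m<n∨m≡n k<
...   | inj₁ k+1< = m , k+1< , ℕₚ.≤-trans ≤2k (ℕₚ.*-monoʳ-≤ 2 (ℕₚ.n≤1+n (suc k)))
-- The power has been reached, so it is doubled, and the upper bound holds with equality.
...   | inj₂ eq = suc m , ℕₚ.<-≤-trans (ℕₚ.m<m*n (2 + k) 2 (s≤s (s≤s z≤n)))
                     (ℕₚ.≤-reflexive (trans (ℕₚ.*-comm (suc (suc k)) 2) (cong (2 *_) eq)))
                 , ℕₚ.≤-reflexive (cong (2 *_) (sym eq))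

-- The drawing

-- Given directly in lowest terms, so that injectivity is read off from the numerator.
ι : ℤ → ℚ
ι z = mkℚ z 0 (Coprimality.sym (Coprimality.1-coprimeTo ℤ.∣ z ∣))

ι-injective : ∀ {a b} → ι a ≡ ι b → a ≡ b
ι-injective = cong ℚ.numerator

ι-mono : ∀ {a b} → a ℤ.≤ b → ι a ℚ.≤ ι b
ι-mono a≤b = ℚ.*≤* (ℤₚ.*-monoʳ-≤-nonNeg (+ 1) a≤b)

right≡suc : ∀ x → right x ≡ ℤ.suc x
right≡suc (+ i)        = refl
right≡suc -[1+ zero ]  = refl
right≡suc -[1+ suc i ] = refl

ι-right : ∀ x → ι (right x) ≡ ι x ℚ.+ 1ℚ
ι-right x = trans (sym (ℚₚ.↥p/↧p≡p (ι (right x))))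
  (cong (ℚ._/ 1) (trans (right≡suc x) (trans (ℤₚ.+-comm (+ 1) x) (cong (ℤ._+ (+ 1)) (sym (ℤₚ.*-identityʳ x))))))

ι-< : ∀ {a b} → a ℤ.< b → ι a ℚ.+ 1ℚ ℚ.≤ ι b
ι-< {a} a<b = subst (ℚ._≤ _) (ι-right a) (ι-mono (subst (ℤ._≤ _) (sym (right≡suc a)) (ℤₚ.i<j⇒suc[i]≤j a<b)))

halve-mono : ∀ {x y} → x ℤ.≤ y → halve x ℤ.≤ halve y
halve-mono (ℤ.-≤- n≤m) = ℤ.-≤- (ℕₚ.⌊n/2⌋-mono n≤m)
halve-mono ℤ.-≤+       = ℤ.-≤+
halve-mono (ℤ.+≤+ m≤n) = ℤ.+≤+ (ℕₚ.⌊n/2⌋-mono m≤n)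

Unit : ℚ → Set
Unit t = 0ℚ ℚ.≤ t × t ℚ.≤ 1ℚ

≤-shift : ∀ {a b c d} → a ℚ.≤ b → a ≡ c ℚ.+ d → b ≡ c → d ℚ.≤ 0ℚ
≤-shift {c = c} {d} a≤b a≡ b≡ = subst₂ ℚ._≤_ (cancel c d) (ℚₚ.+-inverseˡ c)
  (ℚₚ.+-monoʳ-≤ (ℚ.- c) (subst₂ ℚ._≤_ a≡ b≡ a≤b))
  where
  cancel : ∀ c d → ℚ.- c ℚ.+ (c ℚ.+ d) ≡ d
  cancel = solve 2 (λ c d → :- c :+ (c :+ d) := d) refl where open +-*-Solver

1-t≤0⇒t≡1 : ∀ {t} → Unit t → 1ℚ ℚ.- t ℚ.≤ 0ℚ → t ≡ 1ℚ
1-t≤0⇒t≡1 {t} (_ , t≤1) le = ℚₚ.≤-antisym t≤1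
  (subst₂ ℚ._≤_ (cancel t) (ℚₚ.+-identityˡ t) (ℚₚ.+-monoˡ-≤ t le))
  where
  cancel : ∀ t → 1ℚ ℚ.- t ℚ.+ t ≡ 1ℚ
  cancel = solve 1 (λ t → con 1ℚ :- t :+ t := con 1ℚ) refl where open +-*-Solver

0≤1-t : ∀ {t} → t ℚ.≤ 1ℚ → 0ℚ ℚ.≤ 1ℚ ℚ.- t
0≤1-t {t} t≤1 = subst (ℚ._≤ 1ℚ ℚ.- t) (ℚₚ.+-inverseʳ t) (ℚₚ.+-monoˡ-≤ (ℚ.- t) t≤1)

-- In a + t ≤ a + 1 ≤ b ≤ b + t′ the outer terms agree, so equality holds throughout.
step-≡ : ∀ {a b t t′} → a ℤ.< b → Unit t → Unit t′ → ι a ℚ.+ t ≡ ι b ℚ.+ t′ → t ≡ 1ℚ × t′ ≡ 0ℚ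
step-≡ {a} {b} {t} {t′} a<b ut ut′ eq = t≡1 , ℚₚ.≤-antisym
    (≤-shift {c = 1ℚ} t≤ refl t≡1) (proj₁ ut′)
  where
  split : ∀ a t t′ → a ℚ.+ 1ℚ ℚ.+ t′ ≡ (a ℚ.+ t) ℚ.+ (1ℚ ℚ.+ t′ ℚ.- t)
  split = solve 3 (λ a t t′ → a :+ con 1ℚ :+ t′ := (a :+ t) :+ (con 1ℚ :+ t′ :- t)) refl where open +-*-Solver
  cancel : ∀ t t′ → 1ℚ ℚ.+ t′ ℚ.- t ℚ.+ t ≡ 1ℚ ℚ.+ t′
  cancel = solve 2 (λ t t′ → con 1ℚ :+ t′ :- t :+ t := con 1ℚ :+ t′) refl where open +-*-Solver
  t≤ : 1ℚ ℚ.+ t′ ℚ.≤ t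
  t≤ = subst₂ ℚ._≤_ (cancel t t′) (ℚₚ.+-identityˡ t) (ℚₚ.+-monoˡ-≤ t
    (≤-shift (ℚₚ.+-monoˡ-≤ t′ (ι-< a<b)) (split (ι a) t t′) (sym eq)))
  t≡1 : t ≡ 1ℚ
  t≡1 = ℚₚ.≤-antisym (proj₂ ut) (ℚₚ.≤-trans (subst (ℚ._≤ 1ℚ ℚ.+ t′) (ℚₚ.+-identityʳ 1ℚ) (ℚₚ.+-monoʳ-≤ 1ℚ (proj₁ ut′))) t≤)

-- The ways in which points of the unit intervals starting at a and b can coincide: at the same
-- place of one interval, or at a common end of two.
data Meet (a b : ℤ) (t t′ : ℚ) : Set where
  same   : a ≡ b → t ≡ t′ → Meet a b t t′
  before : t ≡ 1ℚ → t′ ≡ 0ℚ → Meet a b t t′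
  after  : t ≡ 0ℚ → t′ ≡ 1ℚ → Meet a b t t′

meet : ∀ a b t t′ → Unit t → Unit t′ → ι a ℚ.+ t ≡ ι b ℚ.+ t′ → Meet a b t t′
meet a b t t′ ut ut′ eq with ℤₚ.<-cmp a b
... | tri< a<b _ _ = let t≡1 , t′≡0 = step-≡ a<b ut ut′ eq in before t≡1 t′≡0
... | tri≈ _ refl _ = same refl (∙-cancelˡ (ι a) _ _ eq)
... | tri> _ _ b<a = let t′≡1 , t≡0 = step-≡ b<a ut′ ut (sym eq) in after t≡0 t′≡1

unit0 : Unit 0ℚ
unit0 = ℚₚ.≤-refl , ℚₚ.nonNegative⁻¹ 1ℚ

slant : ℤ → ℚ → ℚ
slant x t = (1ℚ ℚ.- t) ℚ.* ι x ℚ.+ t ℚ.* ι (halve x)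

-- Halving is monotone, so both ends of one segment lie to the left of those of
-- the other.
slanted : ∀ x x′ t → x ℤ.< x′ → Unit t → slant x t ≡ slant x′ t → t ≡ 1ℚ
slanted x x′ t x< ut@(0≤t , t≤1) eq = 1-t≤0⇒t≡1 ut
  (≤-shift (ℚₚ.+-mono-≤ (ℚₚ.*-monoˡ-≤-nonNeg (1ℚ ℚ.- t) {{ℚ.nonNegative (0≤1-t t≤1)}} (ι-< x<))
                        (ℚₚ.*-monoˡ-≤-nonNeg t {{ℚ.nonNegative 0≤t}} (ι-mono (halve-mono (ℤₚ.<⇒≤ x<)))))
           (split (ι x) (ι (halve x)) t) (sym eq))
  where
  split : ∀ x y t → (1ℚ ℚ.- t) ℚ.* (x ℚ.+ 1ℚ) ℚ.+ t ℚ.* y ≡ ((1ℚ ℚ.- t) ℚ.* x ℚ.+ t ℚ.* y) ℚ.+ (1ℚ ℚ.- t)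
  split = solve 3 (λ x y t → (con 1ℚ :- t) :* (x :+ con 1ℚ) :+ t :* y :=
    ((con 1ℚ :- t) :* x :+ t :* y) :+ (con 1ℚ :- t)) refl where open +-*-Solver

point : Pt → Point
point (x , h) = ι x , ι (+ h)

point-injective : ∀ {p p′} → point p ≡ point p′ → p ≡ p′
point-injective eq = cong₂ _,_ (ι-injective (cong proj₁ eq)) (ℤₚ.+-injective (ι-injective (cong proj₂ eq)))

at-0 : ∀ a b → (1ℚ ℚ.- 0ℚ) ℚ.* a ℚ.+ 0ℚ ℚ.* b ≡ a
at-0 = solve 2 (λ a b → (con 1ℚ :- con 0ℚ) :* a :+ con 0ℚ :* b := a) refl where open +-*-Solver

at-1 : ∀ a b → (1ℚ ℚ.- 1ℚ) ℚ.* a ℚ.+ 1ℚ ℚ.* b ≡ b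
at-1 = solve 2 (λ a b → (con 1ℚ :- con 1ℚ) :* a :+ con 1ℚ :* b := b) refl where open +-*-Solver

same-end : ∀ h t → (1ℚ ℚ.- t) ℚ.* h ℚ.+ t ℚ.* h ≡ h
same-end = solve 2 (λ h t → (con 1ℚ :- t) :* h :+ t :* h := h) refl where open +-*-Solver

unit-step : ∀ h t → (1ℚ ℚ.- t) ℚ.* h ℚ.+ t ℚ.* (h ℚ.+ 1ℚ) ≡ h ℚ.+ t
unit-step = solve 2 (λ h t → (con 1ℚ :- t) :* h :+ t :* (h :+ con 1ℚ) := h :+ t) refl where open +-*-Solver

Seg : Link → Point → Set
Seg κ q = q ∈[ point (src κ) , point (tgt κ) ]

End : Link → Point → Set
End κ q = q ≡ point (src κ) ⊎ q ≡ point (tgt κ)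

module _ (a b : Point) {q : Point} (s : q ∈[ a , b ]) where

  unit : Unit (proj₁ s)
  unit = proj₁ (proj₂ s) , proj₁ (proj₂ (proj₂ s))

  t≡0⇒start : proj₁ s ≡ 0ℚ → q ≡ a
  t≡0⇒start refl = let _ , _ , _ , x≡ , y≡ = s in
    cong₂ _,_ (trans x≡ (at-0 (proj₁ a) (proj₁ b))) (trans y≡ (at-0 (proj₂ a) (proj₂ b)))

  t≡1⇒stop : proj₁ s ≡ 1ℚ → q ≡ b
  t≡1⇒stop refl = let _ , _ , _ , x≡ , y≡ = s in
    cong₂ _,_ (trans x≡ (at-1 (proj₁ a) (proj₁ b))) (trans y≡ (at-1 (proj₂ a) (proj₂ b)))

module _ (κ : Link) {q : Point} (s : Seg κ q) where

  starts : proj₁ s ≡ 0ℚ → End κ q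
  starts eq = inj₁ (t≡0⇒start (point (src κ)) (point (tgt κ)) s eq)

  stops : proj₁ s ≡ 1ℚ → End κ q
  stops eq = inj₂ (t≡1⇒stop (point (src κ)) (point (tgt κ)) s eq)

  seg-unit : Unit (proj₁ s)
  seg-unit = unit (point (src κ)) (point (tgt κ)) s

module _ (x : ℤ) (h : ℕ) {q : Point} where

  up-x : (s : Seg (up (x , h)) q) → proj₁ q ≡ slant x (proj₁ s)
  up-x (_ , _ , _ , x≡ , _) = x≡

  up-y : (s : Seg (up (x , h)) q) → proj₂ q ≡ ι (+ h) ℚ.+ proj₁ s
  up-y (t , _ , _ , _ , y≡) = trans y≡
    (trans (cong (λ z → (1ℚ ℚ.- t) ℚ.* ι (+ h) ℚ.+ t ℚ.* z) (ι-right (+ h))) (unit-step (ι (+ h)) t))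

  across-x : (s : Seg (across (x , h)) q) → proj₁ q ≡ ι x ℚ.+ proj₁ s
  across-x (t , _ , _ , x≡ , _) = trans x≡
    (trans (cong (λ z → (1ℚ ℚ.- t) ℚ.* ι x ℚ.+ t ℚ.* z) (ι-right x)) (unit-step (ι x) t))

  across-y : Seg (across (x , h)) q → proj₂ q ≡ ι (+ h)
  across-y (t , _ , _ , _ , y≡) = trans y≡ (same-end (ι (+ h)) t)

meets-at-end : ∀ κ {q a b t′} (s : Seg κ q) → (a ≡ b → proj₁ s ≡ t′ → End κ q) → Meet a b (proj₁ s) t′ → End κ q
meets-at-end κ s f (same a≡b t≡)  = f a≡b t≡
meets-at-end κ s f (before t≡1 _) = stops κ s t≡1
meets-at-end κ s f (after t≡0 _)  = starts κ s t≡0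

-- Slants from distinct columns of one row keep their order at every height before the end, so they
-- can meet only in a common parent.
slants-cross : ∀ x x′ h {q} → x ≢ x′ → (s : Seg (up (x , h)) q) (s′ : Seg (up (x′ , h)) q) →
  proj₁ s ≡ proj₁ s′ → End (up (x , h)) q
slants-cross x x′ h x≢ s s′ t≡t′ = stops (up (x , h)) s (by-order (ℤₚ.<-cmp x x′))
  where
  slants : slant x (proj₁ s) ≡ slant x′ (proj₁ s)
  slants = trans (sym (up-x x h s)) (trans (up-x x′ h s′) (cong (slant x′) (sym t≡t′)))
  by-order : Tri (x ℤ.< x′) (x ≡ x′) (x′ ℤ.< x) → proj₁ s ≡ 1ℚ
  by-order (tri< x< _ _) = slanted x x′ (proj₁ s) x< (seg-unit (up (x , h)) s) slants
  by-order (tri≈ _ eq _) = ⊥-elim (x≢ eq)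
  by-order (tri> _ _ x>) = slanted x′ x (proj₁ s) x> (seg-unit (up (x , h)) s) (sym slants)

-- Heights are compared if a link goes up, columns if both run across. Unless `Meet` puts the point
-- at an end already, the links share this integer coordinate, and the other coordinate decides.
crossing : ∀ κ κ′ {q} → κ ≢ κ′ → Seg κ q → Seg κ′ q → End κ q ⊎ End κ′ q
crossing κ@(up (x , h)) κ′@(up (x′ , h′)) κ≢ s s′ = inj₁ (meets-at-end κ s
  (λ { refl → slants-cross x x′ h (λ { refl → κ≢ refl }) s s′ })
  (meet (+ h) (+ h′) (proj₁ s) (proj₁ s′) (seg-unit κ s) (seg-unit κ′ s′) (trans (sym (up-y x h s)) (up-y x′ h′ s′))))
-- The constant height of the across link counts as parameter 0, so a common row puts the point at
-- the lower end of the up link.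
crossing κ@(up (x , h)) κ′@(across (x′ , h′)) κ≢ s s′ = inj₁ (meets-at-end κ s (λ _ → starts κ s)
  (meet (+ h) (+ h′) (proj₁ s) 0ℚ (seg-unit κ s) unit0
    (trans (sym (up-y x h s)) (trans (across-y x′ h′ s′) (sym (ℚₚ.+-identityʳ (ι (+ h′))))))))
crossing κ@(across _) κ′@(up _) κ≢ s s′ = Sum.swap (crossing κ′ κ (κ≢ ∘ sym) s′ s)
crossing κ@(across (x , h)) κ′@(across (x′ , h′)) κ≢ s s′ = inj₁ (meets-at-end κ s
  (λ { refl → ⊥-elim (κ≢ (cong (λ h → across (x , h))
         (ℤₚ.+-injective (ι-injective (trans (sym (across-y x h s)) (across-y x′ h′ s′)))))) })
  (meet x x′ (proj₁ s) (proj₁ s′) (seg-unit κ s) (seg-unit κ′ s′) (trans (sym (across-x x h s)) (across-x x′ h′ s′))))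

-- A node has integer coordinates, hence parameter 0 in the coordinate along which the link advances
-- by one.
node-on-link : ∀ p κ → Seg κ (point p) → p ≡ src κ ⊎ p ≡ tgt κ
node-on-link p κ s = Sum.map point-injective point-injective (meets-at-end κ s (λ _ → starts κ s) (meets κ s))
  where
  coordinate : Link → ℤ × ℤ
  coordinate (up (x , h))     = + h , + proj₂ p
  coordinate (across (x , h)) = x , proj₁ p
  meets : ∀ κ (s : Seg κ (point p)) → Meet (proj₁ (coordinate κ)) (proj₂ (coordinate κ)) (proj₁ s) 0ℚ
  meets κ@(up (x , h)) s = meet (+ h) (+ proj₂ p) (proj₁ s) 0ℚ (seg-unit κ s) unit0
    (trans (sym (up-y x h s)) (sym (ℚₚ.+-identityʳ (ι (+ proj₂ p)))))
  meets κ@(across (x , h)) s = meet x (proj₁ p) (proj₁ s) 0ℚ (seg-unit κ s) unit0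
    (trans (sym (across-x x h s)) (sym (ℚₚ.+-identityʳ (ι (proj₁ p)))))

-- Dangling edges and the outer face

0≤ι : ∀ h → 0ℚ ℚ.≤ ι (+ h)
0≤ι h = ι-mono {+ 0} {+ h} (ℤ.+≤+ z≤n)

-- This leaves the open lower half-plane to the dangling edges.
link-above : ∀ κ {q} → Seg κ q → 0ℚ ℚ.≤ proj₂ q
link-above κ@(up (x , h)) s = subst (0ℚ ℚ.≤_) (sym (up-y x h s)) (ℚₚ.+-mono-≤ (0≤ι h) (proj₁ (seg-unit κ s)))
link-above (across (x , h)) s = subst (0ℚ ℚ.≤_) (sym (across-y x h s)) (0≤ι h)

below : ℤ → Point
below x = ι x , ℚ.- 1ℚ

Dangle : ℤ → Point → Set
Dangle x q = q ∈[ point (x , 0) , below x ]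

module _ (x : ℤ) {q : Point} (s : Dangle x q) where

  dangle-x : proj₁ q ≡ ι x
  dangle-x = let t , _ , _ , x≡ , _ = s in trans x≡ (same-end (ι x) t)

  dangle-y : proj₂ q ≡ ℚ.- proj₁ s
  dangle-y = let t , _ , _ , _ , y≡ = s in trans y≡ (down t)
    where
    down : ∀ t → (1ℚ ℚ.- t) ℚ.* 0ℚ ℚ.+ t ℚ.* (ℚ.- 1ℚ) ≡ ℚ.- t
    down = solve 1 (λ t → (con 1ℚ :- t) :* con 0ℚ :+ t :* (:- con 1ℚ) := :- t) refl where open +-*-Solver

  dangle-start : 0ℚ ℚ.≤ proj₂ q → q ≡ point (x , 0)
  dangle-start 0≤y = t≡0⇒start (point (x , 0)) (below x) s (ℚₚ.≤-antisym
    (subst (ℚ._≤ 0ℚ) (neg-involutive (proj₁ s)) (ℚₚ.neg-antimono-≤ (subst (0ℚ ℚ.≤_) dangle-y 0≤y)))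
    (proj₁ (proj₂ s)))

  dangle-below : q ≢ point (x , 0) → proj₂ q ℚ.< 0ℚ
  dangle-below q≢ = ℚₚ.≰⇒> (q≢ ∘ dangle-start)

-- The way out is the vertical segment to depth 1 + |B|. Both of its ends have negative height, and
-- so has every point between.
escape : ∀ (q : Point) → proj₂ q ℚ.< 0ℚ → ∀ B → ∃[ r ] B ℚ.< ∣ proj₁ r ∣ ℚ.⊔ ∣ proj₂ r ∣ ×
  (∀ p → p ∈[ q , r ] → proj₂ p ℚ.< 0ℚ)
escape (x , y) y<0 B = r , ℚₚ.<-≤-trans B< (ℚₚ.p≤q⊔p ∣ x ∣ ∣ ℚ.- d ∣) , stays
  where
  d : ℚ
  d = 1ℚ ℚ.+ ∣ B ∣
  0<d : 0ℚ ℚ.< d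
  0<d = ℚₚ.+-mono-<-≤ {0ℚ} {1ℚ} (ℚₚ.positive⁻¹ 1ℚ) (ℚₚ.0≤∣p∣ B)
  r : Point
  r = x , ℚ.- d
  B< : B ℚ.< ∣ ℚ.- d ∣
  B< = subst (B ℚ.<_) (trans (sym (ℚₚ.0≤p⇒∣p∣≡p (ℚₚ.<⇒≤ 0<d))) (sym (ℚₚ.∣-p∣≡∣p∣ d)))
    (ℚₚ.≤-<-trans (B≤∣B∣ B) (subst (ℚ._< d) (ℚₚ.+-identityˡ ∣ B ∣) (ℚₚ.+-monoˡ-< ∣ B ∣ {0ℚ} {1ℚ} (ℚₚ.positive⁻¹ 1ℚ))))
    where
    B≤∣B∣ : ∀ p → p ℚ.≤ ∣ p ∣
    B≤∣B∣ p with ℚₚ.≤-total 0ℚ p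
    ... | inj₁ 0≤p = ℚₚ.≤-reflexive (sym (ℚₚ.0≤p⇒∣p∣≡p 0≤p))
    ... | inj₂ p≤0 = ℚₚ.≤-trans p≤0 (ℚₚ.0≤∣p∣ p)
  u : ℚ
  u = y ℚ.⊔ ℚ.- d
  u<0 : u ℚ.< 0ℚ
  u<0 with ℚₚ.⊔-sel y (ℚ.- d)
  ... | inj₁ eq = subst (ℚ._< 0ℚ) (sym eq) y<0
  ... | inj₂ eq = subst (ℚ._< 0ℚ) (sym eq) (ℚₚ.neg-antimono-< 0<d)
  stays : ∀ p → p ∈[ (x , y) , r ] → proj₂ p ℚ.< 0ℚ
  stays p (t , 0≤t , t≤1 , _ , y≡) = ℚₚ.≤-<-trans
    (subst₂ ℚ._≤_ (sym y≡) (same-end u t)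
      (ℚₚ.+-mono-≤ (ℚₚ.*-monoˡ-≤-nonNeg (1ℚ ℚ.- t) {{ℚ.nonNegative (0≤1-t t≤1)}} (ℚₚ.p≤p⊔q y (ℚ.- d)))
                   (ℚₚ.*-monoˡ-≤-nonNeg t {{ℚ.nonNegative 0≤t}} (ℚₚ.p≤q⊔p y (ℚ.- d)))))
    u<0

-- Permuting an input into sorted form

sorted : ∀ k → ℕ → Vec Bool k
sorted zero    w       = []
sorted (suc k) zero    = false ∷ sorted k zero
sorted (suc k) (suc w) = true ∷ sorted k w

infix 4 _~_
_~_ : ∀ {k} → Vec Bool k → Vec Bool k → Set
x ~ y = ∃[ π ] permute π x ≡ y

~-refl : ∀ {k} {x : Vec Bool k} → x ~ x
~-refl = Perm.id , Vecₚ.tabulate∘lookup _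

~-trans : ∀ {k} {x y z : Vec Bool k} → x ~ y → y ~ z → x ~ z
-- `permute` looks positions up, so a position passes through the later permutation ρ first.
~-trans {x = x} (π , refl) (ρ , refl) = ρ ∘ₚ π , Vecₚ.tabulate-cong λ i →
  sym (Vecₚ.lookup∘tabulate (λ j → lookup x (π ⟨$⟩ʳ j)) (ρ ⟨$⟩ʳ i))

~-cons : ∀ {k} b {x y : Vec Bool k} → x ~ y → b ∷ x ~ b ∷ y
~-cons b (π , refl) = lift₀ π , refl

~-swap : ∀ {k} a b (x : Vec Bool k) → a ∷ b ∷ x ~ b ∷ a ∷ x
~-swap a b x = transpose zero (suc zero) , cong (λ xs → b ∷ a ∷ xs) (Vecₚ.tabulate∘lookup x)

-- The leading `false` moves to the right past one `true` after another.
sorted-false : ∀ k w → w ≤ k → false ∷ sorted k w ~ sorted (suc k) w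
sorted-false k       zero    _         = ~-refl
sorted-false (suc k) (suc w) (s≤s w≤k) = ~-trans {x = false ∷ true ∷ sorted k w}
  (~-swap false true (sorted k w)) (~-cons true {x = false ∷ sorted k w} (sorted-false k w w≤k))

sort : ∀ {k} (y : Vec Bool k) → y ~ sorted k (ones (lookup y) 0)
sort []          = ~-refl
sort (true ∷ y)  = ~-cons true {x = y} (sort y)
sort (false ∷ y) = ~-trans {x = false ∷ y} (~-cons false {x = y} (sort y)) (sorted-false _ _ (ones-≤ (lookup y)))

at-local : ∀ {k} {d d′ : Fin k → Bool} i → (∀ j → toℕ j ≡ i → d j ≡ d′ j) → at d i ≡ at d′ i
at-local {zero}  i       eq = refl
at-local {suc k} zero    eq = eq zero refl
at-local {suc k} (suc i) eq = at-local {k} i (λ j j≡ → eq (suc j) (cong suc j≡))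

-- Assembly of the gadget and its drawing

module Construction (m k : ℕ) (k< : k < 2 ^ m) where
  open Rules m

  input : Fin k → Pt
  input j = -[1+ toℕ j ] , 0

  input-injective : ∀ {j j′} → input j ≡ input j′ → j ≡ j′
  input-injective eq = Finₚ.toℕ-injective (ℤₚ.-[1+-injective (cong proj₁ eq))

  network : Network
  network = record
    { _≟ⁿ_ = _≟ᵖ_ ; _≟ˡ_ = _≟ᵏ_
    ; nodes = points m ; nodes! = points! m
    ; links = links m ; links! = links! m
    ; src = src ; tgt = tgt
    ; src∈ = λ {κ} κ∈ → ∈-points⁺ m (src κ) (valid-src m κ (∈-links⁻ m κ∈))
    ; tgt∈ = λ {κ} κ∈ → ∈-points⁺ m (tgt κ) (valid-tgt m κ (∈-links⁻ m κ∈))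
    ; parallel = parallel ; antiparallel = antiparallel
    ; place = input
    ; place∈ = λ j → ∈-points⁺ m (input j) (ℕₚ.<-trans (Finₚ.toℕ<n j) k<)
    ; place-inj = input-injective
    }

  module Net = Network network
  open Net using (node; link; srcᵛ; tgtᵛ; placeᵛ; node-src; node-tgt; node-place; node-inj; Touches; AgreeAt)

  owner-end : ∀ κ → Touches (owner κ) κ
  owner-end (up (+ i , h))      = inj₂ refl
  owner-end (up (-[1+ i ] , h)) = inj₁ refl
  owner-end (across p)          = inj₁ refl

  rule-local : ∀ κ {a a′} {d d′ : Fin k → Bool} → AgreeAt (owner κ) a a′ d d′ → rule a d κ ≡ rule a′ d′ κ
  rule-local κ {a} {a′} {d} {d′} agree = go κ agree
    where
    module _ {p} (agree : AgreeAt p a a′ d d′) where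
      left-agrees : ∀ x {h} → (x , h) ≡ p → a (across (left x , h)) ≡ a′ (across (left x , h))
      left-agrees x {h} refl = proj₁ agree _ (inj₂ (cong (_, h) (sym (right-left x))))
      child-agrees : ∀ i n {h} → ⌊ n /2⌋ ≡ i → (-[1+ i ] , suc h) ≡ p → a (up (-[1+ n ] , h)) ≡ a′ (up (-[1+ n ] , h))
      child-agrees i n refl refl = proj₁ agree _ (inj₂ refl)
    go : ∀ κ → AgreeAt (owner κ) a a′ d d′ → rule a d κ ≡ rule a′ d′ κ
    go (up (-[1+ i ] , zero)) agree = at-local i (λ j j≡ → proj₂ agree j (cong (λ n → -[1+ n ] , 0) (sym j≡)))
    go (up (-[1+ i ] , suc h)) agree
      rewrite child-agrees agree i (double i) {h} (half-double i) refl
            | child-agrees agree i (suc (double i)) {h} (half-suc-double i) refl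
            | left-agrees agree -[1+ i ] {suc h} refl = refl
    go (up (+ i , h)) agree
      rewrite proj₁ agree (up (parent (+ i , h))) (inj₁ refl)
            | left-agrees agree (halve (+ i)) {suc h} refl = refl
    go (across (x , zero)) agree = refl
    go (across (-[1+ i ] , suc h)) agree
      rewrite child-agrees agree i (double i) {h} (half-double i) refl
            | child-agrees agree i (suc (double i)) {h} (half-suc-double i) refl
            | left-agrees agree -[1+ i ] {suc h} refl = refl
    go (across (+ i , suc h)) agree = left-agrees agree (+ i) {suc h} refl

  module _ (F : BoolFun k) where

    -- `sorted k i` represents the inputs of weight i. A leaf without the token contributes 1 and
    -- leaves the product unchanged.
    weight : Pt → (Link → Bool) → 𝔸
    weight (+ i , zero)      a = if a (up (+ i , 0)) then F (sorted k i) else 1𝔸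
    weight (+ i , suc h)     a = 1𝔸
    weight (-[1+ i ] , h)    a = 1𝔸

    weight-local : ∀ p {a a′} → (∀ κ → Touches p κ → a κ ≡ a′ κ) → weight p a ≡ weight p a′
    weight-local (+ i , zero)   agree rewrite agree (up (+ i , 0)) (inj₁ refl) = refl
    weight-local (+ i , suc h)  agree = refl
    weight-local (-[1+ i ] , h) agree = refl

    system : Net.System
    system = record
      { rule = rule ; owner = owner ; owner-end = owner-end ; rule-local = rule-local
      ; weight = weight ; weight-local = weight-local }

    module Sys = Net.System system

    module _ (y : Vec Bool k) where

      d : Fin k → Bool
      d = lookup y

      open Count d using (q)

      W : ℕ
      W = ones d 0

      -- `run` may be `true` on absent links, for instance above the top node, so it is cut down to
      -- the valid ones.
      assignment : Link → Bool
      assignment κ with valid? m κ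
      ... | yes _ = run k< d κ
      ... | no  _ = false

      on : ∀ κ → Valid m κ → assignment κ ≡ run k< d κ
      on κ v with valid? m κ
      ... | yes _ = refl
      ... | no ¬v = ⊥-elim (¬v v)

      off : ∀ κ → ¬ Valid m κ → assignment κ ≡ false
      off κ ¬v with valid? m κ
      ... | yes v = ⊥-elim (¬v v)
      ... | no _  = refl

      assignment-unique : ∀ {a} → (∀ {κ} → κ ∈ links m → a κ ≡ rule a d κ) → (∀ {κ} → κ ∉ links m → a κ ≡ false) →
        ∀ {κ} → κ ∈ links m → a κ ≡ assignment κ
      assignment-unique r o {κ} κ∈ = trans
        (unique k< d (record { valid = λ κ → r ∘ ∈-links⁺ m κ ; invalid = λ κ ¬v → o (¬v ∘ ∈-links⁻ m) }) κ v)
        (sym (on κ v))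
        where v = ∈-links⁻ m κ∈

      -- With m = 0 a leaf would have no link through which the token could arrive.
      0<m : NonZero k → 0 < m
      0<m k≢0 = ℕₚ.n≢0⇒n>0 λ m≡0 →
        ℕ.≢-nonZero⁻¹ k {{k≢0}} (ℕₚ.n<1⇒n≡0 (subst (λ n → k < 2 ^ n) m≡0 k<))

      W∈ : In m (+ W , 0)
      W∈ = Count.q-in d m 0 k< z≤n

      ≡ᵇ-refl : ∀ n → (n ≡ᵇ n) ≡ true
      ≡ᵇ-refl zero    = refl
      ≡ᵇ-refl (suc n) = ≡ᵇ-refl n

      selected : 0 < m → value (weight (+ W , 0) assignment) ≡ value (F (sorted k W))
      selected 0<m rewrite on (up (+ W , 0)) (W∈ , in-parent m 0 0<m W∈) | ≡ᵇ-refl W = refl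

      idle : ∀ i → i ≢ W → assignment (up (+ i , 0)) ≡ false
      idle i i≢W with valid? m (up (+ i , 0))
      ... | no  _ = refl
      ... | yes _ with i ≡ᵇ W in eq
      ...   | false = refl
      ...   | true  = ⊥-elim (i≢W (ℕₚ.≡ᵇ⇒≡ i W (subst T (sym eq) _)))

      unselected : ∀ p → p ≢ (+ W , 0) → value (weight p assignment) ≈ℂ 1ℂ
      unselected (-[1+ i ] , h) p≢ = ℂₚ.refl
      unselected (+ i , suc h)  p≢ = ℂₚ.refl
      unselected (+ i , zero)   p≢ rewrite idle i (p≢ ∘ cong (λ n → + n , 0)) = ℂₚ.refl

      signature-sorted : NonZero k → Gadget.signature Sys.gadget y ≈ℂ value (F (sorted k W))
      signature-sorted k≢0 = ℂₚ.trans
        (Sys.signature-weight y assignment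
          (λ {κ} κ∈ → Solution.valid sol κ (∈-links⁻ m κ∈))
          (λ {κ} κ∉ → off κ (κ∉ ∘ ∈-links⁺ m κ))
          assignment-unique
          (∈-points⁺ m (+ W , 0) W∈) unselected)
        (ℂₚ.reflexive (selected (0<m k≢0)))
        where sol = solution k< d assignment on off

  -- Dangling edges occur in row 0 only, next to a single link per node.
  labels : Pt → List (Link ⊎ Pt)
  labels (x , zero)  = inj₁ (up (x , 0)) ∷ inj₂ (x , 0) ∷ []
  labels (x , suc h) = map inj₁ (near (x , suc h))

  degree≤5 : ∀ v → length (Net.around v) ≤ 5
  degree≤5 v = ℕₚ.≤-trans (Net.around-length v (labels (node v)) link-label input-label) (short (node v))
    where
    short : ∀ p → length (labels p) ≤ 5
    short (x , zero)  = s≤s (s≤s z≤n)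
    short (x , suc h) = ℕₚ.≤-refl
    near⊆labels : ∀ p {κ} → κ ∈ near p → inj₁ κ ∈ labels p
    near⊆labels (x , zero)  (here refl) = here refl
    near⊆labels (x , suc h) κ∈          = ∈-map⁺ inj₁ κ∈
    link-label : ∀ {κ} → κ ∈ links m → Touches (node v) κ → inj₁ κ ∈ labels (node v)
    link-label {κ} κ∈ t = near⊆labels (node v) (∈-near m κ (∈-links⁻ m κ∈) t)
    input-label : ∀ {j} → node v ≡ input j → inj₂ (input j) ∈ labels (node v)
    input-label eq rewrite eq = there (here refl)

  drawing : PlanarDrawing Net.graph
  drawing = record
    { pos = pos ; freeEnd = λ j → below (proj₁ (input j)) ; bends = λ _ → []
    ; pos-injective = node-inj ∘ point-injective
    ; arcs = arcs
    ; vertexOnEdge = on-edge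
    ; noCrossing = no-crossing
    -- Away from its vertex a dangling edge has negative height, and the path of `escape` stays
    -- below the drawing.
    ; danglingOuter = λ j q s q≢ B →
        let r , B< , stays = escape q (dangle-below _ (dangle j s) (q≢ ∘ (λ eq → trans eq (sym (pos-input j))))) B
        in r , [] , B< , λ p p∈ drawn → ℚₚ.<-irrefl refl (ℚₚ.<-≤-trans (stays p p∈)
             ([ at-node , (λ (e , s) → link-above (link e) (seg e s)) ]′ drawn))
    }
    where
    pos : Graph.Vertex Net.graph → Point
    pos v = point (node v)

    pos-input : ∀ j → pos (placeᵛ j) ≡ point (input j)
    pos-input j = cong point (node-place j)

    start stop : Net.Edge → Point
    start = [ pos ∘ srcᵛ , pos ∘ placeᵛ ]′
    stop  = [ pos ∘ tgtᵛ , below ∘ proj₁ ∘ input ]′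

    seg : ∀ e {q} → q ∈[ pos (srcᵛ e) , pos (tgtᵛ e) ] → Seg (link e) q
    seg e {q} = subst₂ (λ a b → q ∈[ point a , point b ]) (node-src e) (node-tgt e)

    dangle : ∀ j {q} → q ∈[ pos (placeᵛ j) , below (proj₁ (input j)) ] → Dangle (proj₁ (input j)) q
    dangle j {q} = subst (λ a → q ∈[ a , below (proj₁ (input j)) ]) (pos-input j)

    at-node : ∀ {q} → ∃[ v ] q ≡ pos v → 0ℚ ℚ.≤ proj₂ q
    at-node (v , refl) = 0≤ι (proj₂ (node v))

    arcs : ∀ e → start e ≢ stop e
    arcs (inj₁ e) eq = Graph.loopless Net.graph e (node-inj (point-injective eq))
    arcs (inj₂ j) eq with trans (sym (cong proj₂ (pos-input j))) (cong proj₂ eq)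
    ... | ()

    on-edge : ∀ v e → pos v ∈[ start e , stop e ] → Net.Incident v e
    on-edge v (inj₁ e) s = Net.touches⇒incident v e (node-on-link (node v) (link e) (seg e s))
    on-edge v (inj₂ j) s = node-inj (point-injective
      (trans (dangle-start _ (dangle j s) (at-node (v , refl))) (sym (pos-input j))))

    end-vertex : ∀ e {q} → End (link e) q → ∃[ v ] q ≡ pos v
    end-vertex e (inj₁ eq) = srcᵛ e , trans eq (cong point (sym (node-src e)))
    end-vertex e (inj₂ eq) = tgtᵛ e , trans eq (cong point (sym (node-tgt e)))

    foot : ∀ j κ {q} → q ∈[ pos (placeᵛ j) , below (proj₁ (input j)) ] → Seg κ q → ∃[ v ] q ≡ pos v
    foot j κ s s′ = placeᵛ j , trans (dangle-start _ (dangle j s) (link-above κ s′)) (sym (pos-input j))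

    no-crossing : ∀ e e′ → e ≢ e′ → ∀ q → q ∈[ start e , stop e ] → q ∈[ start e′ , stop e′ ] → ∃[ v ] q ≡ pos v
    no-crossing (inj₁ e) (inj₁ e′) e≢ q s s′ = [ end-vertex e , end-vertex e′ ]′
      (crossing (link e) (link e′) (e≢ ∘ cong inj₁ ∘ lookup-injective (links! m)) (seg e s) (seg e′ s′))
    no-crossing (inj₁ e) (inj₂ j) e≢ q s s′ = foot j (link e) s′ (seg e s)
    no-crossing (inj₂ j) (inj₁ e) e≢ q s s′ = foot j (link e) s (seg e s′)
    no-crossing (inj₂ j) (inj₂ j′) e≢ q s s′ = ⊥-elim (e≢ (cong inj₂ (input-injective (cong (_, 0)
      (ι-injective (trans (sym (dangle-x _ (dangle j s))) (dangle-x _ (dangle j′ s′))))))))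

mainTheorem3 : ∃[ C ] (∀ (k : ℕ) .{{_ : NonZero k}} (F : BoolFun k) → Symmetric F →
    ∃[ G ] Planar {k} G
    × (∀ y → Gadget.signature G y ≈ℂ value (F y))
    × Gadget.n G ≤ C * k
    × (∀ v → Gadget.degree G v ≤ 5))
-- The constant is 4 from `length-points` times 2 from `power-above`.
mainTheorem3 = 8 , main
  where
  main : ∀ (k : ℕ) .{{_ : NonZero k}} (F : BoolFun k) → Symmetric F →
    ∃[ G ] Planar {k} G
    × (∀ y → Gadget.signature G y ≈ℂ value (F y))
    × Gadget.n G ≤ 8 * k
    × (∀ v → Gadget.degree G v ≤ 5)
  main (suc k) F sym-F with power-above k
  ... | m , k< , m≤ = C.Sys.gadget F , C.drawing , signature , size≤ , C.degree≤5
    where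
    module C = Construction m (suc k) k<
    signature : ∀ y → Gadget.signature (C.Sys.gadget F) y ≈ℂ value (F y)
    signature y = ℂₚ.trans (C.signature-sorted F y _)
      -- The gadget computes `F` at the sorted input; symmetry carries this value over to `y`.
      (let π , eq = sort y in subst (λ x → value (F x) ≈ℂ value (F y)) eq (sym-F π y))
    size≤ : length (points m) ≤ 8 * suc k
    size≤ = ℕₚ.≤-trans (length-points m)
      (ℕₚ.≤-trans (ℕₚ.*-monoʳ-≤ 4 m≤) (ℕₚ.≤-reflexive (sym (ℕₚ.*-assoc 4 2 (suc k)))))
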